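{- Let $\mathcal{D}=(X,\mathcal{G},\mathcal{B})$ be an $\mathrm{STD}_\lambda[k;g]$, so that $v=|X|=\lambda g^2$ and $k=\lambda g$, where $\lambda\ge1$, $g\ge2$ and $(\lambda,g)\notin\{(1,2),(1,3),(2,2)\}$. Then there exists a semi-resolving set for the points of $\mathcal{D}$ of size $\left\lceil\frac{v\log v}{k-\lambda}\right\rceil$, i.e. a set $S_\mathcal{B}\subseteq\mathcal{B}$ of that size such that for every pair of distinct points $x,y\in X$ some block of $S_\mathcal{B}$ contains exactly one of $x,y$ (equivalently, is at different distances from $x$ and $y$ in the incidence graph).
   Context: A transversal design $\mathrm{TD}_\lambda[k;g]$ ($g\ge2$) is a triple $(X,\mathcal{G},\mathcal{B})$ where $X$ is a set of $kg$ points, $\mathcal{G}$ is a partition of $X$ into $k$ point classes of size $g$, and $\mathcal{B}$ is a family of $k$-subsets of $X$ (blocks) such that each block contains exactly one point of each point class and any two points from distinct point classes lie in exactly $\lambda$ blocks. It is symmetric (an $\mathrm{STD}_\lambda[k;g]$) if its dual (interchanging points and blocks) is also a $\mathrm{TD}_\lambda[k;g]$; then $k=\lambda g$ and $|X|=|\mathcal{B}|=\lambda g^2$. The incidence graph is the bipartite graph on $X\cup\mathcal{B}$ with $x$ adjacent to $B$ iff $x\in B$. $\log$ is the natural logarithm. -}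

module Defs where

open import Data.Empty using (⊥)
open import Data.Fin.Base using (Fin)
open import Data.Fin.Subset using (Subset; _∈_; _∉_; _∩_; ∣_∣)
open import Data.Integer.Base as ℤ using (ℤ; +_)
import Data.Integer.Properties as ℤₚ
open import Data.Nat.Base as ℕ using (ℕ; zero; suc)
import Data.Nat.Properties as ℕₚ
open import Data.Nat.Tactic.RingSolver using (solve-∀)
open import Data.Product using (∃; ∃!; _×_; _,_; proj₁; proj₂)
open import Data.Rational.Base as ℚ using (ℚ; 0ℚ; 1ℚ; _/_; mkℚ)
import Data.Rational.Properties as ℚₚ
open import Algebra.Properties.Group ℚₚ.+-0-group using (⁻¹-involutive)
import Data.Rational.Unnormalised.Base as ℚᵘ
import Data.Rational.Unnormalised.Properties as ℚᵘₚ
open import Data.Sum.Base using (_⊎_; inj₁; inj₂)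
open import Data.Vec.Base using (lookup; tabulate)
open import Relation.Binary.PropositionalEquality
open import Relation.Nullary using (¬_)

------------------------------------------------------------------------
-- Transversal designs.  An incidence structure with v points and b
-- blocks is an indexed family B : Fin b → Subset v, so repeated blocks
-- are allowed a priori.

dual : ∀ {v b} → (Fin b → Subset v) → (Fin v → Subset b)
dual B x = tabulate λ j → lookup (B j) x

record TransversalDesign (l k g : ℕ) {v b : ℕ} (B : Fin b → Subset v) : Set where
  field
    2≤g         : 2 ℕ.≤ g
    points      : v ≡ k ℕ.* g
    G           : Fin k → Subset v
    partition   : ∀ x → ∃! _≡_ λ i → x ∈ G i
    class-size  : ∀ i → ∣ G i ∣ ≡ g
    block-size  : ∀ j → ∣ B j ∣ ≡ k
    transversal : ∀ j i → ∣ B j ∩ G i ∣ ≡ 1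
    -- dual B x is the set of (indices of) blocks through x.
    balanced    : ∀ {x y i i′} → x ∈ G i → y ∈ G i′ → i ≢ i′ →
                  ∣ dual B x ∩ dual B y ∣ ≡ l

record SymmetricTransversalDesign (l k g : ℕ) {v b : ℕ} (B : Fin b → Subset v) : Set where
  field
    design      : TransversalDesign l k g B
    dual-design : TransversalDesign l k g (dual B)

ContainsExactlyOne : ∀ {v} → Subset v → Fin v → Fin v → Set
ContainsExactlyOne s x y = (x ∈ s × y ∉ s) ⊎ (x ∉ s × y ∈ s)

SemiResolvingForPoints : ∀ {v b} → (Fin b → Subset v) → Subset b → Set
SemiResolvingForPoints B S =
  ∀ x y → x ≢ y → ∃ λ j → j ∈ S × ContainsExactlyOne (B j) x y

module IncidenceGraph {v b : ℕ} (B : Fin b → Subset v) where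

  Vertex : Set
  Vertex = Fin v ⊎ Fin b

  Adjacent : Vertex → Vertex → Set
  Adjacent (inj₁ x) (inj₂ j) = x ∈ B j
  Adjacent (inj₂ j) (inj₁ x) = x ∈ B j
  Adjacent (inj₁ _) (inj₁ _) = ⊥
  Adjacent (inj₂ _) (inj₂ _) = ⊥

  data Walk : Vertex → Vertex → ℕ → Set where
    []  : ∀ {u} → Walk u u 0
    _∷_ : ∀ {u w z n} → Adjacent u w → Walk w z n → Walk u z (suc n)

  IsDistance : Vertex → Vertex → ℕ → Set
  IsDistance u w d = Walk u w d × (∀ {n} → Walk u w n → d ℕ.≤ n)

  AtDifferentDistances : Vertex → Vertex → Vertex → Set
  AtDifferentDistances w u u′ =
    ∃ λ d → ∃ λ d′ → IsDistance w u d × IsDistance w u′ d′ × d ≢ d′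

------------------------------------------------------------------------
-- Real numbers as Cauchy sequences of rationals

record ℝ : Set where
  field
    seq    : ℕ → ℚ
    cauchy : ∀ ε → 0ℚ ℚ.< ε → ∃ λ N → ∀ m n → N ℕ.≤ m → N ℕ.≤ n →
             ℚ.∣ seq m ℚ.- seq n ∣ ℚ.≤ ε
open ℝ public

infix 4 _<ʳ_ _≤ʳ_

_<ʳ_ : ℝ → ℝ → Set
x <ʳ y = ∃ λ ε → 0ℚ ℚ.< ε × ∃ λ N → ∀ n → N ℕ.≤ n → seq x n ℚ.+ ε ℚ.≤ seq y n

_≤ʳ_ : ℝ → ℝ → Set
x ≤ʳ y = ¬ (y <ʳ x)

private
  ∣p-p∣≤ε : ∀ p {ε} → 0ℚ ℚ.< ε → ℚ.∣ p ℚ.- p ∣ ℚ.≤ ε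
  ∣p-p∣≤ε p 0<ε rewrite ℚₚ.+-inverseʳ p = ℚₚ.<⇒≤ 0<ε

fromℚ : ℚ → ℝ
fromℚ q = record { seq = λ _ → q ; cauchy = λ ε 0<ε → 0 , λ _ _ _ _ → ∣p-p∣≤ε q 0<ε }

fromℤ : ℤ → ℝ
fromℤ z = fromℚ (z / 1)

private
  scale-cauchy : ∀ c (x : ℝ) ε → 0ℚ ℚ.< ε → ∃ λ N → ∀ m n → N ℕ.≤ m → N ℕ.≤ n →
                 ℚ.∣ c ℚ.* seq x m ℚ.- c ℚ.* seq x n ∣ ℚ.≤ ε
  scale-cauchy c x ε 0<ε = proj₁ c′ , λ m n N≤m N≤n → bound m n (proj₂ c′ m n N≤m N≤n)
    where
    K : ℚ
    K = ℚ.∣ c ∣ ℚ.+ 1ℚ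
    instance
      absNonNeg : ℚ.NonNegative ℚ.∣ c ∣
      absNonNeg = ℚₚ.∣-∣-nonNeg c
      Kpos : ℚ.Positive K
      Kpos = ℚₚ.nonNeg+pos⇒pos ℚ.∣ c ∣ 1ℚ
      Knz : ℚ.NonZero K
      Knz = ℚₚ.pos⇒nonZero K
      εpos : ℚ.Positive ε
      εpos = ℚ.positive 0<ε
      1/Kpos : ℚ.Positive (ℚ.1/ K)
      1/Kpos = ℚₚ.1/pos⇒pos K
    δ : ℚ
    δ = ℚ.1/ K ℚ.* ε
    instance
      δpos : ℚ.Positive δ
      δpos = ℚₚ.pos*pos⇒pos (ℚ.1/ K) ε
      δnonNeg : ℚ.NonNegative δ
      δnonNeg = ℚₚ.pos⇒nonNeg δ
    c′ = cauchy x δ (ℚₚ.positive⁻¹ δ)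
    bound : ∀ m n → ℚ.∣ seq x m ℚ.- seq x n ∣ ℚ.≤ δ →
            ℚ.∣ c ℚ.* seq x m ℚ.- c ℚ.* seq x n ∣ ℚ.≤ ε
    bound m n h = begin
      ℚ.∣ c ℚ.* a ℚ.- c ℚ.* a′ ∣          ≡⟨ cong (λ t → ℚ.∣ c ℚ.* a ℚ.+ t ∣) (ℚₚ.neg-distribʳ-* c a′) ⟩
      ℚ.∣ c ℚ.* a ℚ.+ c ℚ.* (ℚ.- a′) ∣    ≡⟨ cong ℚ.∣_∣ (ℚₚ.*-distribˡ-+ c a (ℚ.- a′)) ⟨
      ℚ.∣ c ℚ.* (a ℚ.- a′) ∣              ≡⟨ ℚₚ.∣p*q∣≡∣p∣*∣q∣ c (a ℚ.- a′) ⟩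
      ℚ.∣ c ∣ ℚ.* ℚ.∣ a ℚ.- a′ ∣          ≤⟨ ℚₚ.*-monoˡ-≤-nonNeg ℚ.∣ c ∣ h ⟩
      ℚ.∣ c ∣ ℚ.* δ                       ≡⟨ ℚₚ.+-identityʳ _ ⟨
      ℚ.∣ c ∣ ℚ.* δ ℚ.+ 0ℚ                ≤⟨ ℚₚ.+-monoʳ-≤ (ℚ.∣ c ∣ ℚ.* δ) (ℚₚ.nonNegative⁻¹ δ) ⟩
      ℚ.∣ c ∣ ℚ.* δ ℚ.+ δ                 ≡⟨ cong (ℚ.∣ c ∣ ℚ.* δ ℚ.+_) (ℚₚ.*-identityˡ δ) ⟨
      ℚ.∣ c ∣ ℚ.* δ ℚ.+ 1ℚ ℚ.* δ          ≡⟨ ℚₚ.*-distribʳ-+ δ ℚ.∣ c ∣ 1ℚ ⟨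
      K ℚ.* δ                             ≡⟨ ℚₚ.*-assoc K (ℚ.1/ K) ε ⟨
      (K ℚ.* ℚ.1/ K) ℚ.* ε                ≡⟨ cong (ℚ._* ε) (ℚₚ.*-inverseʳ K) ⟩
      1ℚ ℚ.* ε                            ≡⟨ ℚₚ.*-identityˡ ε ⟩
      ε                                   ∎
      where
      open ℚₚ.≤-Reasoning
      a = seq x m
      a′ = seq x n

infixr 7 _·_

_·_ : ℚ → ℝ → ℝ
c · x = record { seq = λ n → c ℚ.* seq x n ; cauchy = scale-cauchy c x }

-- z = ⌈ x ⌉.  A relation, since the order on ℝ is not decidable;
-- ceiling-unique and ceiling-¬¬exists say that it is classically a
-- total function.
IsCeiling : ℤ → ℝ → Set
IsCeiling z x = fromℤ (z ℤ.- + 1) <ʳ x × x ≤ʳ fromℤ z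

------------------------------------------------------------------------
-- The natural logarithm of a natural number m ≥ 1, as ∫₁ᵐ dt/t: the
-- limit of the lower Darboux sums on the partitions of mesh 1/(N+1),
--   Σ { (1/(N+1)) · 1/(i/(N+1)) | N+1 < i ≤ m(N+1) }.
-- For m = 0 it takes the junk value 0.

sumTo : ℕ → (ℕ → ℚ) → ℚ
sumTo zero    f = 0ℚ
sumTo (suc n) f = sumTo n f ℚ.+ f n

logSum : ℕ → ℕ → ℚ
logSum m N = sumTo ((m ℕ.∸ 1) ℕ.* suc N) λ j → + 1 / suc (suc N ℕ.+ j)

module Darboux where
  r : ℕ → ℚ
  r n = + 1 / suc n

  toᵘ : ∀ i n → ℚ.toℚᵘ (i / suc n) ℚᵘ.≃ ℚᵘ.mkℚᵘ i n
  toᵘ i n = ℚₚ.toℚᵘ-fromℚᵘ (ℚᵘ.mkℚᵘ i n)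

  r-anti : ∀ {m n} → m ℕ.≤ n → r n ℚ.≤ r m
  r-anti {m} {n} m≤n = ℚₚ.toℚᵘ-cancel-≤
    (ℚᵘₚ.≤-respˡ-≃ (ℚᵘₚ.≃-sym (toᵘ (+ 1) n)) (ℚᵘₚ.≤-respʳ-≃ (ℚᵘₚ.≃-sym (toᵘ (+ 1) m))
      (ℚᵘ.*≤* (ℤₚ.*-monoˡ-≤-nonNeg (+ 1) (ℤ.+≤+ (ℕ.s≤s m≤n))))))

  -- (M+1) · 1/((x+1)(M+1)) = 1/(x+1)
  r-block : ∀ x M → (+ suc M / 1) ℚ.* r (M ℕ.+ x ℕ.* suc M) ≡ r x
  r-block x M = ℚₚ.toℚᵘ-injective (begin
    ℚ.toℚᵘ ((+ suc M / 1) ℚ.* r y)              ≈⟨ ℚₚ.toℚᵘ-homo-* (+ suc M / 1) (r y) ⟩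
    ℚ.toℚᵘ (+ suc M / 1) ℚᵘ.* ℚ.toℚᵘ (r y)      ≈⟨ ℚᵘₚ.*-cong (toᵘ (+ suc M) 0) (toᵘ (+ 1) y) ⟩
    ℚᵘ.mkℚᵘ (+ suc M) 0 ℚᵘ.* ℚᵘ.mkℚᵘ (+ 1) y    ≈⟨ ℚᵘ.*≡* (cong +_ (eq x M)) ⟩
    ℚᵘ.mkℚᵘ (+ 1) x                             ≈⟨ toᵘ (+ 1) x ⟨
    ℚ.toℚᵘ (r x)                                ∎)
    where
    open ℚᵘₚ.≃-Reasoning
    y = M ℕ.+ x ℕ.* suc M
    eq : ∀ x M → (suc M ℕ.* 1) ℕ.* suc x ≡ 1 ℕ.* (1 ℕ.* suc (M ℕ.+ x ℕ.* suc M))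
    eq = solve-∀

  sumTo-+ : ∀ p q f → sumTo (p ℕ.+ q) f ≡ sumTo p f ℚ.+ sumTo q (λ j → f (p ℕ.+ j))
  sumTo-+ p zero f rewrite ℕₚ.+-identityʳ p = sym (ℚₚ.+-identityʳ _)
  sumTo-+ p (suc q) f rewrite ℕₚ.+-suc p q | sumTo-+ p q f = ℚₚ.+-assoc (sumTo p f) _ _

  suc-* : ∀ M c → (+ suc M / 1) ℚ.* c ≡ (+ M / 1) ℚ.* c ℚ.+ c
  suc-* M c = begin
    (+ suc M / 1) ℚ.* c                 ≡⟨ cong (ℚ._* c) eq ⟩
    (+ M / 1 ℚ.+ 1ℚ) ℚ.* c              ≡⟨ ℚₚ.*-distribʳ-+ c (+ M / 1) 1ℚ ⟩
    (+ M / 1) ℚ.* c ℚ.+ 1ℚ ℚ.* c        ≡⟨ cong ((+ M / 1) ℚ.* c ℚ.+_) (ℚₚ.*-identityˡ c) ⟩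
    (+ M / 1) ℚ.* c ℚ.+ c               ∎
    where
    open ≡-Reasoning
    nat : ∀ M → (suc M ℕ.* 1) ≡ (M ℕ.* 1 ℕ.+ 1) ℕ.* 1
    nat = solve-∀
    eq : + suc M / 1 ≡ + M / 1 ℚ.+ 1ℚ
    eq = ℚₚ.toℚᵘ-injective (ℚᵘₚ.≃-trans (toᵘ (+ suc M) 0) (ℚᵘₚ.≃-sym
           (ℚᵘₚ.≃-trans (ℚₚ.toℚᵘ-homo-+ (+ M / 1) 1ℚ)
           (ℚᵘₚ.≃-trans (ℚᵘₚ.+-cong (toᵘ (+ M) 0) (ℚᵘₚ.≃-refl {ℚᵘ.1ℚᵘ}))
             (ℚᵘₚ.≃-sym (ℚᵘ.*≡* (trans (cong +_ (nat M)) (lem M))))))))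
      where
      lem : ∀ M → + ((M ℕ.* 1 ℕ.+ 1) ℕ.* 1) ≡ (+ M ℤ.* + 1 ℤ.+ + 1 ℤ.* + 1) ℤ.* + 1
      lem M = trans (ℤₚ.pos-* (M ℕ.* 1 ℕ.+ 1) 1)
                (cong (ℤ._* + 1) (cong (ℤ._+ + 1) (ℤₚ.pos-* M 1)))

  sumTo-lower : ∀ M f c → (∀ j → j ℕ.< M → c ℚ.≤ f j) → (+ M / 1) ℚ.* c ℚ.≤ sumTo M f
  sumTo-lower zero f c h = ℚₚ.≤-reflexive (ℚₚ.*-zeroˡ c)
  sumTo-lower (suc M) f c h = subst (ℚ._≤ _) (sym (suc-* M c))
    (ℚₚ.+-mono-≤ (sumTo-lower M f c (λ j j<M → h j (ℕₚ.m≤n⇒m≤1+n j<M))) (h M ℕₚ.≤-refl))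

  sumTo-upper : ∀ M f c → (∀ j → j ℕ.< M → f j ℚ.≤ c) → sumTo M f ℚ.≤ (+ M / 1) ℚ.* c
  sumTo-upper zero f c h = ℚₚ.≤-reflexive (sym (ℚₚ.*-zeroˡ c))
  sumTo-upper (suc M) f c h = subst (_ ℚ.≤_) (sym (suc-* M c))
    (ℚₚ.+-mono-≤ (sumTo-upper M f c (λ j j<M → h j (ℕₚ.m≤n⇒m≤1+n j<M))) (h M ℕₚ.≤-refl))

  -- Σ { 1/i | a < i ≤ a + len }
  harm : ℕ → ℕ → ℚ
  harm a len = sumTo len λ j → r (a ℕ.+ j)

  harm-split : ∀ a len M → harm (a ℕ.* suc M) (suc len ℕ.* suc M) ≡
    harm (a ℕ.* suc M) (len ℕ.* suc M) ℚ.+ sumTo (suc M) (λ j → r (a ℕ.* suc M ℕ.+ (len ℕ.* suc M ℕ.+ j)))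
  harm-split a len M = trans (cong (harm (a ℕ.* suc M)) (ℕₚ.+-comm (suc M) (len ℕ.* suc M)))
    (sumTo-+ (len ℕ.* suc M) (suc M) _)

  refine-lower : ∀ a len M → harm a len ℚ.≤ harm (a ℕ.* suc M) (len ℕ.* suc M)
  refine-lower a zero M = ℚₚ.≤-refl
  refine-lower a (suc len) M = subst (_ ℚ.≤_) (sym (harm-split a len M))
    (ℚₚ.+-mono-≤ (refine-lower a len M)
      (ℚₚ.≤-trans (ℚₚ.≤-reflexive (sym (r-block (a ℕ.+ len) M)))
        (sumTo-lower (suc M) f (r (M ℕ.+ (a ℕ.+ len) ℕ.* suc M)) λ j j≤M → r-anti (le j j≤M))))
    where
    f : ℕ → ℚ
    f j = r (a ℕ.* suc M ℕ.+ (len ℕ.* suc M ℕ.+ j))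
    nat : ∀ a len M j → a ℕ.* suc M ℕ.+ (len ℕ.* suc M ℕ.+ j) ≡ j ℕ.+ (a ℕ.+ len) ℕ.* suc M
    nat = solve-∀
    le : ∀ j → j ℕ.< suc M → a ℕ.* suc M ℕ.+ (len ℕ.* suc M ℕ.+ j) ℕ.≤ M ℕ.+ (a ℕ.+ len) ℕ.* suc M
    le j (ℕ.s≤s j≤M) rewrite nat a len M j = ℕₚ.+-monoˡ-≤ _ j≤M

  refine-upper : ∀ N len M → harm (suc N ℕ.* suc M) (len ℕ.* suc M) ℚ.≤ harm N len
  refine-upper N zero M = ℚₚ.≤-refl
  refine-upper N (suc len) M = subst (ℚ._≤ _) (sym (harm-split (suc N) len M))
    (ℚₚ.+-mono-≤ (refine-upper N len M)
      (ℚₚ.≤-trans (sumTo-upper (suc M) f (r (M ℕ.+ (N ℕ.+ len) ℕ.* suc M)) λ j _ → r-anti (le j))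
        (ℚₚ.≤-reflexive (r-block (N ℕ.+ len) M))))
    where
    f : ℕ → ℚ
    f j = r (suc N ℕ.* suc M ℕ.+ (len ℕ.* suc M ℕ.+ j))
    nat : ∀ N len M j → suc N ℕ.* suc M ℕ.+ (len ℕ.* suc M ℕ.+ j) ≡
                        (M ℕ.+ (N ℕ.+ len) ℕ.* suc M) ℕ.+ suc j
    nat = solve-∀
    le : ∀ j → M ℕ.+ (N ℕ.+ len) ℕ.* suc M ℕ.≤ suc N ℕ.* suc M ℕ.+ (len ℕ.* suc M ℕ.+ j)
    le j rewrite nat N len M j = ℕₚ.m≤m+n _ _

  harm-shift : ∀ N len → harm N len ℚ.+ r (N ℕ.+ len) ≡ r N ℚ.+ harm (suc N) len
  harm-shift N zero rewrite ℕₚ.+-identityʳ N =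
    trans (ℚₚ.+-identityˡ (r N)) (sym (ℚₚ.+-identityʳ (r N)))
  harm-shift N (suc len) rewrite ℕₚ.+-suc N len =
    trans (cong (ℚ._+ r (suc (N ℕ.+ len))) (harm-shift N len)) (ℚₚ.+-assoc (r N) _ _)

  0≤r : ∀ n → 0ℚ ℚ.≤ r n
  0≤r n = ℚₚ.nonNegative⁻¹ (r n) {{ℚₚ.normalize-nonNeg 1 (suc n)}}

  harm-step : ∀ N len → harm N len ℚ.≤ r N ℚ.+ harm (suc N) len
  harm-step N len = subst₂ ℚ._≤_ (ℚₚ.+-identityʳ _) (harm-shift N len)
    (ℚₚ.+-monoʳ-≤ (harm N len) (0≤r (N ℕ.+ len)))

  logSum-≤ : ∀ m N M → logSum m N ℚ.≤ r M ℚ.+ logSum m M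
  logSum-≤ m N M = ℚₚ.≤-trans (refine-lower (suc N) (p ℕ.* suc N) M)
    (ℚₚ.≤-trans (ℚₚ.≤-reflexive (cong₂ harm (ℕₚ.*-comm (suc N) (suc M)) eq))
    (ℚₚ.≤-trans (refine-upper M (p ℕ.* suc M) N) (harm-step M (p ℕ.* suc M))))
    where
    p = m ℕ.∸ 1
    nat : ∀ p N M → p ℕ.* suc N ℕ.* suc M ≡ p ℕ.* suc M ℕ.* suc N
    nat = solve-∀
    eq : p ℕ.* suc N ℕ.* suc M ≡ p ℕ.* suc M ℕ.* suc N
    eq = nat p N M

  p≤s+q⇒p-q≤s : ∀ {p q s} → p ℚ.≤ s ℚ.+ q → p ℚ.- q ℚ.≤ s
  p≤s+q⇒p-q≤s {p} {q} {s} h = begin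
    p ℚ.- q             ≤⟨ ℚₚ.+-monoˡ-≤ (ℚ.- q) h ⟩
    s ℚ.+ q ℚ.- q       ≡⟨ ℚₚ.+-assoc s q (ℚ.- q) ⟩
    s ℚ.+ (q ℚ.- q)     ≡⟨ cong (s ℚ.+_) (ℚₚ.+-inverseʳ q) ⟩
    s ℚ.+ 0ℚ            ≡⟨ ℚₚ.+-identityʳ s ⟩
    s                   ∎
    where open ℚₚ.≤-Reasoning

  neg-minus : ∀ p q → ℚ.- (p ℚ.- q) ≡ q ℚ.- p
  neg-minus p q = begin
    ℚ.- (p ℚ.- q)               ≡⟨ ℚₚ.neg-distrib-+ p (ℚ.- q) ⟩
    ℚ.- p ℚ.+ ℚ.- (ℚ.- q)       ≡⟨ cong (ℚ.- p ℚ.+_) (⁻¹-involutive q) ⟩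
    ℚ.- p ℚ.+ q                 ≡⟨ ℚₚ.+-comm (ℚ.- p) q ⟩
    q ℚ.- p                     ∎
    where open ≡-Reasoning

  abs-≤ : ∀ {p q ε} → p ℚ.≤ ε ℚ.+ q → q ℚ.≤ ε ℚ.+ p → ℚ.∣ p ℚ.- q ∣ ℚ.≤ ε
  abs-≤ {p} {q} h h′ with ℚₚ.∣p∣≡p∨∣p∣≡-p (p ℚ.- q)
  ... | inj₁ eq rewrite eq = p≤s+q⇒p-q≤s h
  ... | inj₂ eq rewrite eq | neg-minus p q = p≤s+q⇒p-q≤s h′

  r≤ε : ∀ ε → 0ℚ ℚ.< ε → r (ℚ.denominator-1 ε) ℚ.≤ ε
  r≤ε ε@(mkℚ (+ zero) d _) 0<ε with () ← ℚ.positive 0<ε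
  r≤ε ε@(mkℚ (ℤ.-[1+ _ ]) d _) 0<ε with () ← ℚ.positive 0<ε
  r≤ε ε@(mkℚ (+ suc n) d _) 0<ε = ℚₚ.toℚᵘ-cancel-≤
    (ℚᵘₚ.≤-respˡ-≃ (ℚᵘₚ.≃-sym (toᵘ (+ 1) d))
      (ℚᵘ.*≤* (ℤₚ.*-monoʳ-≤-nonNeg (+ suc d) {+ 1} {+ suc n} (ℤ.+≤+ (ℕ.s≤s ℕ.z≤n)))))

  logSum-cauchy : ∀ m ε → 0ℚ ℚ.< ε → ∃ λ N → ∀ i j → N ℕ.≤ i → N ℕ.≤ j →
                  ℚ.∣ logSum m i ℚ.- logSum m j ∣ ℚ.≤ ε
  logSum-cauchy m ε 0<ε = ℚ.denominator-1 ε , λ i j N≤i N≤j → abs-≤ (le i j N≤j) (le j i N≤i)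
    where
    le : ∀ i j → ℚ.denominator-1 ε ℕ.≤ j → logSum m i ℚ.≤ ε ℚ.+ logSum m j
    le i j N≤j = ℚₚ.≤-trans (logSum-≤ m i j)
      (ℚₚ.+-monoˡ-≤ (logSum m j) (ℚₚ.≤-trans (r-anti N≤j) (r≤ε ε 0<ε)))

log : ℕ → ℝ
log m = record { seq = logSum m ; cauchy = Darboux.logSum-cauchy m }

------------------------------------------------------------------------
-- Uniqueness and classical existence of ceilings

private
  /1-mono : ∀ {z w} → z ℤ.≤ w → z / 1 ℚ.≤ w / 1
  /1-mono {z} {w} z≤w = ℚₚ.toℚᵘ-cancel-≤
    (ℚᵘₚ.≤-respˡ-≃ (ℚᵘₚ.≃-sym (Darboux.toᵘ z 0)) (ℚᵘₚ.≤-respʳ-≃ (ℚᵘₚ.≃-sym (Darboux.toᵘ w 0))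
      (ℚᵘ.*≤* (ℤₚ.*-monoʳ-≤-nonNeg (+ 1) z≤w))))

  /1-+ : ∀ z w → (z ℤ.+ w) / 1 ≡ z / 1 ℚ.+ w / 1
  /1-+ z w = ℚₚ.toℚᵘ-injective (ℚᵘₚ.≃-trans (Darboux.toᵘ (z ℤ.+ w) 0) (ℚᵘₚ.≃-sym
    (ℚᵘₚ.≃-trans (ℚₚ.toℚᵘ-homo-+ (z / 1) (w / 1))
    (ℚᵘₚ.≃-trans (ℚᵘₚ.+-cong (Darboux.toᵘ z 0) (Darboux.toᵘ w 0))
      (ℚᵘ.*≡* (cong (ℤ._* + 1) (cong₂ ℤ._+_ (ℤₚ.*-identityʳ z) (ℤₚ.*-identityʳ w))))))))

  <ʳ-weaken : ∀ {z w x} → z ℤ.≤ w → fromℤ w <ʳ x → fromℤ z <ʳ x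
  <ʳ-weaken z≤w (ε , 0<ε , N , h) =
    ε , 0<ε , N , λ n N≤n → ℚₚ.≤-trans (ℚₚ.+-monoˡ-≤ ε (/1-mono z≤w)) (h n N≤n)

  suc-pred : ∀ z → z ℤ.+ + 1 ℤ.- + 1 ≡ z
  suc-pred z = trans (ℤₚ.+-assoc z (+ 1) (ℤ.- + 1)) (ℤₚ.+-identityʳ z)

  below-≤ : ∀ {z w x} → IsCeiling z x → IsCeiling w x → ¬ (z ℤ.< w)
  below-≤ {z} {w} {x} (_ , x≤z) (w-1<x , _) z<w = x≤z (<ʳ-weaken {x = x} z≤w-1 w-1<x)
    where
    z≤w-1 : z ℤ.≤ w ℤ.- + 1
    z≤w-1 = subst (ℤ._≤ w ℤ.- + 1) (trans (cong (ℤ._- + 1) (ℤₚ.+-comm (+ 1) z)) (suc-pred z))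
              (ℤₚ.+-monoˡ-≤ (ℤ.- + 1) (ℤₚ.i<j⇒suc[i]≤j z<w))

ceiling-unique : ∀ {z w} x → IsCeiling z x → IsCeiling w x → z ≡ w
ceiling-unique x p q = ℤₚ.≤-antisym (ℤₚ.≮⇒≥ (below-≤ {x = x} q p)) (ℤₚ.≮⇒≥ (below-≤ {x = x} p q))

private
  search : ∀ x fuel z → fromℤ z <ʳ x → ¬ (fromℤ (z ℤ.+ + fuel) <ʳ x) →
           ¬ ¬ ∃ λ c → IsCeiling c x
  search x zero z z<x stop _ = stop (subst (λ t → fromℤ t <ʳ x) (sym (ℤₚ.+-identityʳ z)) z<x)
  search x (suc fuel) z z<x stop none =
    none (z ℤ.+ + 1 , subst (λ t → fromℤ t <ʳ x) (sym (suc-pred z)) z<x , λ z+1<x →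
      search x fuel (z ℤ.+ + 1) z+1<x
        (λ h → stop (subst (λ t → fromℤ t <ʳ x) (ℤₚ.+-assoc z (+ 1) (+ fuel)) h)) none)

  ≤num : ∀ p → p ℚ.≤ + ℤ.∣ ℚ.numerator p ∣ / 1
  ≤num p@(mkℚ n d _) = ℚₚ.toℚᵘ-cancel-≤ (ℚᵘₚ.≤-respʳ-≃ (ℚᵘₚ.≃-sym (Darboux.toᵘ (+ ℤ.∣ n ∣) 0))
    (ℚᵘ.*≤* (ℤₚ.≤-trans (ℤₚ.≤-reflexive (ℤₚ.*-identityʳ n)) (le n))))
    where
    le : ∀ n → n ℤ.≤ + ℤ.∣ n ∣ ℤ.* + suc d
    le (+ n) = subst (+ n ℤ.≤_) (ℤₚ.pos-* n (suc d)) (ℤ.+≤+ (ℕₚ.m≤m*n n (suc d)))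
    le (ℤ.-[1+ n ]) = ℤ.-≤+

  num≤ : ∀ p → ℤ.- + ℤ.∣ ℚ.numerator p ∣ / 1 ℚ.≤ p
  num≤ p = subst₂ ℚ._≤_ eq (⁻¹-involutive p) (ℚₚ.neg-antimono-≤ (≤num (ℚ.- p)))
    where
    neg : ∀ n → ℚ.- (+ n / 1) ≡ ℤ.- + n / 1
    neg zero    = refl
    neg (suc n) = refl
    eq : ℚ.- (+ ℤ.∣ ℚ.numerator (ℚ.- p) ∣ / 1) ≡ ℤ.- + ℤ.∣ ℚ.numerator p ∣ / 1
    eq rewrite ℚₚ.↥-neg p | ℤₚ.∣-i∣≡∣i∣ (ℚ.numerator p) = neg ℤ.∣ ℚ.numerator p ∣

  abs-≥ : ∀ {p q ε} → ℚ.∣ p ℚ.- q ∣ ℚ.≤ ε → p ℚ.≤ q ℚ.+ ε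
  abs-≥ {p} {q} {ε} h = begin
    p                     ≡⟨ ℚₚ.+-identityʳ p ⟨
    p ℚ.+ 0ℚ              ≡⟨ cong (p ℚ.+_) (ℚₚ.+-inverseˡ q) ⟨
    p ℚ.+ (ℚ.- q ℚ.+ q)   ≡⟨ ℚₚ.+-assoc p (ℚ.- q) q ⟨
    (p ℚ.- q) ℚ.+ q       ≤⟨ ℚₚ.+-monoˡ-≤ q (p≤∣p∣ (p ℚ.- q)) ⟩
    ℚ.∣ p ℚ.- q ∣ ℚ.+ q   ≤⟨ ℚₚ.+-monoˡ-≤ q h ⟩
    ε ℚ.+ q               ≡⟨ ℚₚ.+-comm ε q ⟩
    q ℚ.+ ε               ∎
    where
    open ℚₚ.≤-Reasoning
    p≤∣p∣ : ∀ p → p ℚ.≤ ℚ.∣ p ∣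
    p≤∣p∣ p@(mkℚ (+ _) _ _) = ℚₚ.≤-refl
    p≤∣p∣ p@(mkℚ (ℤ.-[1+ _ ]) _ _) = ℚ.*≤* ℤ.-≤+

ceiling-¬¬exists : ∀ x → ¬ ¬ ∃ λ z → IsCeiling z x
ceiling-¬¬exists x = search x (k ℕ.+ k) (ℤ.- + k) low high
  where
  c = cauchy x 1ℚ (ℚₚ.positive⁻¹ 1ℚ)
  N = proj₁ c
  B = ℤ.∣ ℚ.numerator (seq x N) ∣
  k = B ℕ.+ 2
  low : fromℤ (ℤ.- + k) <ʳ x
  low = 1ℚ , ℚₚ.positive⁻¹ 1ℚ , N , λ n N≤n → begin
    (ℤ.- + k) / 1 ℚ.+ 1ℚ                    ≡⟨ cong (λ t → t / 1 ℚ.+ 1ℚ) (ℤₚ.neg-distrib-+ (+ B) (+ 2)) ⟩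
    (ℤ.- + B ℤ.+ ℤ.- + 2) / 1 ℚ.+ 1ℚ        ≡⟨ cong (ℚ._+ 1ℚ) (/1-+ (ℤ.- + B) (ℤ.- + 2)) ⟩
    (ℤ.- + B) / 1 ℚ.+ ℤ.- + 2 / 1 ℚ.+ 1ℚ    ≡⟨ ℚₚ.+-assoc ((ℤ.- + B) / 1) (ℤ.- + 2 / 1) 1ℚ ⟩
    (ℤ.- + B) / 1 ℚ.+ (ℚ.- 1ℚ)              ≤⟨ ℚₚ.+-monoˡ-≤ (ℚ.- 1ℚ) (num≤ (seq x N)) ⟩
    seq x N ℚ.- 1ℚ                          ≤⟨ ℚₚ.+-monoˡ-≤ (ℚ.- 1ℚ) (abs-≥ {seq x N} {seq x n} (proj₂ c N n ℕₚ.≤-refl N≤n)) ⟩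
    seq x n ℚ.+ 1ℚ ℚ.- 1ℚ                   ≡⟨ ℚₚ.+-assoc (seq x n) 1ℚ (ℚ.- 1ℚ) ⟩
    seq x n ℚ.+ 0ℚ                          ≡⟨ ℚₚ.+-identityʳ (seq x n) ⟩
    seq x n                                 ∎
    where open ℚₚ.≤-Reasoning
  x≤k : ∀ n → N ℕ.≤ n → seq x n ℚ.≤ + k / 1
  x≤k n N≤n = begin
    seq x n               ≤⟨ abs-≥ (proj₂ c n N N≤n ℕₚ.≤-refl) ⟩
    seq x N ℚ.+ 1ℚ        ≤⟨ ℚₚ.+-mono-≤ (≤num (seq x N)) (/1-mono {+ 1} {+ 2} (ℤ.+≤+ (ℕ.s≤s ℕ.z≤n))) ⟩
    + B / 1 ℚ.+ + 2 / 1   ≡⟨ /1-+ (+ B) (+ 2) ⟨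
    + k / 1               ∎
    where open ℚₚ.≤-Reasoning
  -k+2k : ℤ.- + k ℤ.+ + (k ℕ.+ k) ≡ + k
  -k+2k = trans (sym (ℤₚ.+-assoc (ℤ.- + k) (+ k) (+ k)))
    (trans (cong (ℤ._+ + k) (ℤₚ.+-inverseˡ (+ k))) (ℤₚ.+-identityˡ (+ k)))
  k≮x : ¬ (fromℤ (+ k) <ʳ x)
  k≮x (ε , 0<ε , M , le) = ℚₚ.<-irrefl refl (begin-strict
    + k / 1             ≡⟨ ℚₚ.+-identityʳ (+ k / 1) ⟨
    + k / 1 ℚ.+ 0ℚ      <⟨ ℚₚ.+-monoʳ-< (+ k / 1) 0<ε ⟩
    + k / 1 ℚ.+ ε       ≤⟨ le (N ℕ.⊔ M) (ℕₚ.m≤n⊔m N M) ⟩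
    seq x (N ℕ.⊔ M)     ≤⟨ x≤k (N ℕ.⊔ M) (ℕₚ.m≤m⊔n N M) ⟩
    + k / 1             ∎)
    where open ℚₚ.≤-Reasoning
  high : ¬ (fromℤ (ℤ.- + k ℤ.+ + (k ℕ.+ k)) <ʳ x)
  high h = k≮x (subst (λ t → fromℤ t <ʳ x) -k+2k h)

{-# OPTIONS --safe #-}
module Submission where

-- Write d = k - l.  Two points of distinct classes are separated by 2d blocks and two points of the
-- same class by 2k blocks, so each block chosen greedily separates at least the fraction 2d/v of the
-- pairs not yet separated.  After n ≥ (v/d) log v choices fewer than (v²/2)(1 - 2d/v)ⁿ < 1 pairs are
-- left.  The set obtained can be enlarged to exactly n blocks because log v ≤ d gives n ≤ v; the
-- inequality log v ≤ d fails exactly for the excluded pairs (l , g).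
--
-- Instead of exponentials, the comparison with log v uses harmonic sums: Σ { 1/i | a < i ≤ c }
-- behaves like log (c/a), is additive in the interval, and is at least (c - a)/c.

open import Data.Bool.Base using (Bool; true; false; not; _∧_; _xor_)
open import Data.Fin.Base using (Fin; zero; suc; fromℕ<)
open import Data.Fin.Properties using (_≟_)
open import Data.Fin.Subset using (Subset; inside; outside; ∣_∣; _∈_; _∩_; _∪_; _⊆_; _-_; ⁅_⁆; ⊤; Nonempty) renaming (⊥ to ∅)
open import Data.Fin.Subset.Properties
open import Data.Integer.Base as ℤ using (+_)
import Data.Integer.Properties as ℤₚ
open import Data.List.Base using (List; _∷_; []; _++_; map; length; filterᵇ; allFin)
open import Data.List.Membership.Propositional using (_∉_) renaming (_∈_ to _∈ₗ_)
open import Data.List.Membership.Propositional.Properties using (∈-allFin)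
open import Data.List.Properties using (length-++; length-map; length-tabulate)
open import Data.List.Relation.Unary.All as All using (All; []; _∷_)
import Data.List.Relation.Unary.All.Properties as Allₚ
open import Data.List.Relation.Unary.AllPairs using (AllPairs; []; _∷_)
open import Data.List.Relation.Unary.Any using (here; there)
open import Data.List.Relation.Unary.Unique.Propositional.Properties using (allFin⁺)
open import Data.Nat.Base as ℕ using (ℕ; zero; suc; z≤n; s≤s; _≤_; _<_; _+_; _*_; _^_; _∸_; NonZero)
import Data.Nat.Properties as ℕₚ
open import Data.Nat.Tactic.RingSolver using (solve-∀)
open import Data.Product using (∃; _×_; _,_; uncurry)
open import Data.Rational.Base as ℚ using (ℚ; 0ℚ; 1ℚ; _/_)
import Data.Rational.Properties as ℚₚ
open import Data.Rational.Solver using (module +-*-Solver)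
import Data.Rational.Unnormalised.Base as ℚᵘ
import Data.Rational.Unnormalised.Properties as ℚᵘₚ
open import Data.Sum.Base as Sum using (_⊎_; inj₁; inj₂)
open import Data.Vec.Base using (lookup; []; _∷_)
open import Data.Vec.Properties using (lookup∘tabulate; lookup-zipWith; []=⇒lookup; lookup⇒[]=)
open import Function.Base using (_∘_; id)
open import Function.Bundles using (_⇔_; mk⇔)
open import Relation.Binary.PropositionalEquality
open import Relation.Nullary using (¬_; yes; no; contradiction)
open import Relation.Nullary.Decidable using (from-yes)
open import Algebra.Properties.Semiring.Sum ℕₚ.+-*-semiring using (sum; ∑-distrib-+; ∑-comm; *-distribˡ-sum; sum-cong-≗)
open import Defs
open Darboux

-- Harmonic sums and logarithms

fromℕ : ℕ → ℚ
fromℕ m = + m / 1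

fromℕ-+ : ∀ m n → fromℕ (m + n) ≡ fromℕ m ℚ.+ fromℕ n
fromℕ-+ m n = ℚₚ.toℚᵘ-injective (begin
  ℚ.toℚᵘ (fromℕ (m + n))               ≈⟨ toᵘ (+ (m + n)) 0 ⟩
  ℚᵘ.mkℚᵘ (+ (m + n)) 0                ≈⟨ ℚᵘ.*≡* (cong (ℤ._* + 1) (sym (cong₂ ℤ._+_ (ℤₚ.*-identityʳ (+ m)) (ℤₚ.*-identityʳ (+ n))))) ⟩
  ℚᵘ.mkℚᵘ (+ m) 0 ℚᵘ.+ ℚᵘ.mkℚᵘ (+ n) 0   ≈⟨ ℚᵘₚ.+-cong (toᵘ (+ m) 0) (toᵘ (+ n) 0) ⟨
  ℚ.toℚᵘ (fromℕ m) ℚᵘ.+ ℚ.toℚᵘ (fromℕ n) ≈⟨ ℚₚ.toℚᵘ-homo-+ (fromℕ m) (fromℕ n) ⟨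
  ℚ.toℚᵘ (fromℕ m ℚ.+ fromℕ n)           ∎)
  where open ℚᵘₚ.≃-Reasoning

fromℕ-* : ∀ m n → fromℕ (m * n) ≡ fromℕ m ℚ.* fromℕ n
fromℕ-* m n = ℚₚ.toℚᵘ-injective (begin
  ℚ.toℚᵘ (fromℕ (m * n))                 ≈⟨ toᵘ (+ (m * n)) 0 ⟩
  ℚᵘ.mkℚᵘ (+ (m * n)) 0                  ≈⟨ ℚᵘ.*≡* (cong (ℤ._* + 1) (ℤₚ.pos-* m n)) ⟩
  ℚᵘ.mkℚᵘ (+ m) 0 ℚᵘ.* ℚᵘ.mkℚᵘ (+ n) 0   ≈⟨ ℚᵘₚ.*-cong (toᵘ (+ m) 0) (toᵘ (+ n) 0) ⟨
  ℚ.toℚᵘ (fromℕ m) ℚᵘ.* ℚ.toℚᵘ (fromℕ n) ≈⟨ ℚₚ.toℚᵘ-homo-* (fromℕ m) (fromℕ n) ⟨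
  ℚ.toℚᵘ (fromℕ m ℚ.* fromℕ n)           ∎)
  where open ℚᵘₚ.≃-Reasoning

fromℕ-mono-≤ : ∀ {m n} → m ≤ n → fromℕ m ℚ.≤ fromℕ n
fromℕ-mono-≤ {m} {n} m≤n = ℚₚ.toℚᵘ-cancel-≤
  (ℚᵘₚ.≤-respˡ-≃ (ℚᵘₚ.≃-sym (toᵘ (+ m) 0)) (ℚᵘₚ.≤-respʳ-≃ (ℚᵘₚ.≃-sym (toᵘ (+ n) 0))
    (ℚᵘ.*≤* (ℤₚ.*-monoʳ-≤-nonNeg (+ 1) (ℤ.+≤+ m≤n)))))

/-as-* : ∀ m x → + m / suc x ≡ fromℕ m ℚ.* r x
/-as-* m x = ℚₚ.toℚᵘ-injective (begin
  ℚ.toℚᵘ (+ m / suc x)                   ≈⟨ toᵘ (+ m) x ⟩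
  ℚᵘ.mkℚᵘ (+ m) x                        ≈⟨ ℚᵘ.*≡* (cong₂ ℤ._*_ (sym (ℤₚ.*-identityʳ (+ m))) (cong (λ t → + suc t) (ℕₚ.+-identityʳ x))) ⟩
  ℚᵘ.mkℚᵘ (+ m) 0 ℚᵘ.* ℚᵘ.mkℚᵘ (+ 1) x   ≈⟨ ℚᵘₚ.*-cong (toᵘ (+ m) 0) (toᵘ (+ 1) x) ⟨
  ℚ.toℚᵘ (fromℕ m) ℚᵘ.* ℚ.toℚᵘ (r x)     ≈⟨ ℚₚ.toℚᵘ-homo-* (fromℕ m) (r x) ⟨
  ℚ.toℚᵘ (fromℕ m ℚ.* r x)               ∎)
  where open ℚᵘₚ.≃-Reasoning

fromℕ-*-r : ∀ x → fromℕ (suc x) ℚ.* r x ≡ 1ℚ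
fromℕ-*-r x = subst (λ t → fromℕ (suc x) ℚ.* r t ≡ 1ℚ) (ℕₚ.+-identityʳ x) (r-block 0 x)

+-cancelʳ-≤ : ∀ {p q} s → p ℚ.+ s ℚ.≤ q ℚ.+ s → p ℚ.≤ q
+-cancelʳ-≤ s p+s≤q+s = ℚₚ.≮⇒≥ λ q<p →
  ℚₚ.<-irrefl refl (ℚₚ.<-≤-trans (ℚₚ.+-monoˡ-< s q<p) p+s≤q+s)

r-nonNeg : ∀ x → ℚ.NonNegative (r x)
r-nonNeg x = ℚₚ.normalize-nonNeg 1 (suc x)

r-blocks : ∀ x m M → fromℕ (m * suc M) ℚ.* r (M + x * suc M) ≡ fromℕ m ℚ.* r x
r-blocks x m M = begin
  fromℕ (m * suc M) ℚ.* y             ≡⟨ cong (ℚ._* y) (fromℕ-* m (suc M)) ⟩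
  fromℕ m ℚ.* fromℕ (suc M) ℚ.* y     ≡⟨ ℚₚ.*-assoc (fromℕ m) (fromℕ (suc M)) y ⟩
  fromℕ m ℚ.* (fromℕ (suc M) ℚ.* y)   ≡⟨ cong (fromℕ m ℚ.*_) (r-block x M) ⟩
  fromℕ m ℚ.* r x                     ∎
  where
  open ≡-Reasoning
  y = r (M + x * suc M)

-- By `eq` the largest denominator in the range is `suc x * suc M`, so each of the `m * suc M` terms
-- is at least its reciprocal.
harm-≥ : ∀ x m M a → a + m * suc M ≡ suc x * suc M → fromℕ m ℚ.* r x ℚ.≤ harm a (m * suc M)
harm-≥ x m M a eq = ℚₚ.≤-trans (ℚₚ.≤-reflexive (sym (r-blocks x m M)))
  (sumTo-lower (m * suc M) _ _ λ j j< →
    r-anti (ℕ.s≤s⁻¹ (subst (suc (a + j) ≤_) eq (ℕₚ.+-monoʳ-< a j<))))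

-- The range starts after `suc x * suc M`, so every term is below that reciprocal. This is the
-- harmonic form of log (1 + m/(x+1)) ≤ m/(x+1).
harm-≤ : ∀ x m M → harm (suc x * suc M) (m * suc M) ℚ.≤ fromℕ m ℚ.* r x
harm-≤ x m M = ℚₚ.≤-trans
  (sumTo-upper (m * suc M) _ _ λ j _ → r-anti {M + x * suc M} (ℕₚ.≤-trans (ℕₚ.n≤1+n _) (ℕₚ.m≤m+n _ j)))
  (ℚₚ.≤-reflexive (r-blocks x m M))

harm-+ : ∀ a p q → harm a (p + q) ≡ harm a p ℚ.+ harm (a + p) q
harm-+ a p q = trans (sumTo-+ p q _) (cong (harm a p ℚ.+_) (sumTo-cong q λ j → cong r (sym (ℕₚ.+-assoc a p j))))
  where
  sumTo-cong : ∀ n {f g : ℕ → ℚ} → (∀ j → f j ≡ g j) → sumTo n f ≡ sumTo n g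
  sumTo-cong zero    f≗g = refl
  sumTo-cong (suc n) f≗g = cong₂ ℚ._+_ (sumTo-cong n f≗g) (f≗g n)

-- Σ { 1/i | a < i ≤ c }, an approximation of log (c/a).
between : ℕ → ℕ → ℚ
between a c = harm a (c ∸ a)

between-+ : ∀ a p → between a (a + p) ≡ harm a p
between-+ a p = cong (harm a) (ℕₚ.m+n∸m≡n a p)

between-split : ∀ {a b c} → a ≤ b → b ≤ c → between a c ≡ between a b ℚ.+ between b c
between-split {a} {b} {c} a≤b b≤c with ℕₚ.m≤n⇒∃[o]m+o≡n a≤b | ℕₚ.m≤n⇒∃[o]m+o≡n b≤c
... | p , refl | q , refl = begin
  between a (a + p + q)                          ≡⟨ cong (between a) (ℕₚ.+-assoc a p q) ⟩
  between a (a + (p + q))                        ≡⟨ between-+ a (p + q) ⟩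
  harm a (p + q)                                   ≡⟨ harm-+ a p q ⟩
  harm a p ℚ.+ harm (a + p) q                      ≡⟨ cong₂ ℚ._+_ (between-+ a p) (between-+ (a + p) q) ⟨
  between a (a + p) ℚ.+ between (a + p) (a + p + q) ∎
  where open ≡-Reasoning

0≤harm : ∀ a p → 0ℚ ℚ.≤ harm a p
0≤harm a zero    = ℚₚ.≤-refl
0≤harm a (suc p) = ℚₚ.+-mono-≤ (0≤harm a p) (0≤r (a + p))

between-monoʳ-≤ : ∀ {a b c} → a ≤ b → b ≤ c → between a b ℚ.≤ between a c
between-monoʳ-≤ {a} {b} {c} a≤b b≤c = subst₂ ℚ._≤_ (ℚₚ.+-identityʳ _) (sym (between-split a≤b b≤c))
  (ℚₚ.+-monoʳ-≤ (between a b) (0≤harm b (c ∸ b)))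

-- The mesh factors 1/(N+1) cancel in the Darboux sum, which leaves a harmonic sum over an interval
-- whose end points have ratio `suc x`.
logSum-between : ∀ x N → logSum (suc x) N ≡ between (suc N) (suc x * suc N)
logSum-between x N = sym (between-+ (suc N) (x * suc N))

-- The harmonic form of log ((x+1)/w) ≥ 1 - w/(x+1) = t/(x+1). The common factor `e` is free so that
-- intervals of the same ratio can be joined end to end.
between-≥ : ∀ {x w t} e → 0 < e → w + t ≡ suc x → fromℕ t ℚ.* r x ℚ.≤ between (w * e) (suc x * e)
between-≥ {x} {w} {t} (suc M) _ w+t≡1+x = subst (fromℕ t ℚ.* r x ℚ.≤_)
  (trans (sym (between-+ (w * suc M) (t * suc M))) (cong (between (w * suc M)) eq))
  (harm-≥ x t M (w * suc M) eq)
  where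
  eq : w * suc M + t * suc M ≡ suc x * suc M
  eq = trans (sym (ℕₚ.*-distribʳ-+ (suc M) w t)) (cong (_* suc M) w+t≡1+x)

-- Telescoping through the points wⁿ⁻ⁱ(x+1)ⁱ.
between-^-≥ : ∀ {x w t} n e → 0 < w → 0 < e → w + t ≡ suc x →
              fromℕ n ℚ.* (fromℕ t ℚ.* r x) ℚ.≤ between (w ^ n * e) (suc x ^ n * e)
between-^-≥ {x} {w} {t} zero e 0<w 0<e eq =
  ℚₚ.≤-trans (ℚₚ.≤-reflexive (ℚₚ.*-zeroˡ (fromℕ t ℚ.* r x))) (0≤harm (1 * e) (1 * e ∸ 1 * e))
between-^-≥ {x} {w} {t} (suc n) e 0<w 0<e eq = begin
  fromℕ (suc n) ℚ.* c                                  ≡⟨ suc-* n c ⟩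
  fromℕ n ℚ.* c ℚ.+ c                                  ≡⟨ ℚₚ.+-comm (fromℕ n ℚ.* c) c ⟩
  -- The first interval is taken at scale `w ^ n * e`, the induction hypothesis at scale
  -- `suc x * e`; up to the order of factors the two intervals then share an end point.
  c ℚ.+ fromℕ n ℚ.* c                                  ≤⟨ ℚₚ.+-mono-≤ (between-≥ {x} {w} {t} (w ^ n * e) (ℕₚ.*-mono-≤ (ℕₚ.m^n>0 w {{ℕ.>-nonZero 0<w}} n) 0<e) eq)
                                                            (between-^-≥ n (suc x * e) 0<w (ℕₚ.*-mono-≤ {1} {suc x} (s≤s z≤n) 0<e) eq) ⟩
  between (w * (w ^ n * e)) (suc x * (w ^ n * e)) ℚ.+
    between (w ^ n * (suc x * e)) (suc x ^ n * (suc x * e)) ≡⟨ cong₂ (λ p q → between p (suc x * (w ^ n * e)) ℚ.+ between q (suc x ^ n * (suc x * e)))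
                                                              (nat₁ w (w ^ n) e) (nat₂ (suc x) (w ^ n) e) ⟩
  between (w ^ suc n * e) (suc x * (w ^ n * e)) ℚ.+
    between (suc x * (w ^ n * e)) (suc x ^ n * (suc x * e)) ≡⟨ cong (λ p → between (w ^ suc n * e) (suc x * (w ^ n * e)) ℚ.+ between (suc x * (w ^ n * e)) p) (nat₃ (suc x) (suc x ^ n) e) ⟩
  between (w ^ suc n * e) (suc x * (w ^ n * e)) ℚ.+
    between (suc x * (w ^ n * e)) (suc x ^ suc n * e)   ≡⟨ between-split le₁ le₂ ⟨
  between (w ^ suc n * e) (suc x ^ suc n * e)          ∎
  where
  open ℚₚ.≤-Reasoning
  c = fromℕ t ℚ.* r x
  nat₁ : ∀ w p e → w * (p * e) ≡ w * p * e
  nat₁ = solve-∀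
  nat₂ : ∀ v p e → p * (v * e) ≡ v * (p * e)
  nat₂ = solve-∀
  nat₃ : ∀ v p e → p * (v * e) ≡ v * p * e
  nat₃ = solve-∀
  w≤1+x : w ≤ suc x
  w≤1+x = subst (w ≤_) eq (ℕₚ.m≤m+n w t)
  le₁ : w ^ suc n * e ≤ suc x * (w ^ n * e)
  le₁ = subst (_≤ suc x * (w ^ n * e)) (nat₁ w (w ^ n) e) (ℕₚ.*-monoˡ-≤ (w ^ n * e) w≤1+x)
  le₂ : suc x * (w ^ n * e) ≤ suc x ^ suc n * e
  le₂ = subst (suc x * (w ^ n * e) ≤_) (nat₁ (suc x) (suc x ^ n) e)
          (ℕₚ.*-monoʳ-≤ (suc x) (ℕₚ.*-monoˡ-≤ e (ℕₚ.^-monoˡ-≤ n w≤1+x)))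

-- The interval splits at `suc x * e` into two of ratio `suc x`. Both are Darboux sums for log
-- (x+1), but with meshes 1/e and 1/((x+1)e), hence the two indices.
logSum-square : ∀ x e → 0 < e → ∃ λ N → ∃ λ M →
                between e (suc x ^ 2 * e) ≡ logSum (suc x) N ℚ.+ logSum (suc x) M
logSum-square x (suc N) _ = N , N + x * suc N , (begin
  between (suc N) (suc x ^ 2 * suc N)                                       ≡⟨ cong (between (suc N)) (nat (suc x) (suc N)) ⟩
  between (suc N) (suc x * (suc x * suc N))                                 ≡⟨ between-split (ℕₚ.m≤m+n (suc N) (x * suc N)) (ℕₚ.m≤m+n (suc x * suc N) (x * (suc x * suc N))) ⟩
  between (suc N) (suc x * suc N) ℚ.+ between (suc x * suc N) (suc x * (suc x * suc N)) ≡⟨ cong₂ ℚ._+_ (logSum-between x N) (logSum-between x (N + x * suc N)) ⟨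
  logSum (suc x) N ℚ.+ logSum (suc x) (N + x * suc N)                     ∎)
  where
  open ≡-Reasoning
  nat : ∀ v e → v ^ 2 * e ≡ v * (v * e)
  nat v e = trans (cong (λ t → v * t * e) (ℕₚ.*-identityʳ v)) (ℕₚ.*-assoc v v e)

-- Taking logarithms in 2 · vⁿ ≤ v² · wⁿ; the factor 2 gives the 1/2.
logSum-≥ : ∀ {x w t n} → 0 < w → w + t ≡ suc x → 2 * suc x ^ n ≤ suc x ^ 2 * w ^ n → ∀ N →
           fromℕ n ℚ.* (fromℕ t ℚ.* r x) ℚ.+ r 1 ℚ.≤ (r N ℚ.+ logSum (suc x) N) ℚ.+ (r N ℚ.+ logSum (suc x) N)
logSum-≥ {x} {w} {t} {n} 0<w eq 2vⁿ≤v²wⁿ N with logSum-square x (w ^ n) (ℕₚ.m^n>0 w {{ℕ.>-nonZero 0<w}} n)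
... | N₁ , N₂ , eq′ = begin
  fromℕ n ℚ.* (fromℕ t ℚ.* r x) ℚ.+ r 1                     ≤⟨ ℚₚ.+-mono-≤ lower half ⟩
  between (w ^ n) (suc x ^ n) ℚ.+ between (suc x ^ n) (2 * suc x ^ n) ≡⟨ between-split wⁿ≤vⁿ (ℕₚ.m≤m+n _ _) ⟨
  between (w ^ n) (2 * suc x ^ n)                           ≤⟨ between-monoʳ-≤ (ℕₚ.≤-trans wⁿ≤vⁿ (ℕₚ.m≤m+n _ _)) 2vⁿ≤v²wⁿ ⟩
  between (w ^ n) (suc x ^ 2 * w ^ n)                       ≡⟨ eq′ ⟩
  -- `logSum-≤` moves both sums to the common index `N` at a cost of 1/(N+1) each. As `N` is free,
  -- this error can be made small against the 1/2.
  logSum (suc x) N₁ ℚ.+ logSum (suc x) N₂                   ≤⟨ ℚₚ.+-mono-≤ (logSum-≤ (suc x) N₁ N) (logSum-≤ (suc x) N₂ N) ⟩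
  (r N ℚ.+ logSum (suc x) N) ℚ.+ (r N ℚ.+ logSum (suc x) N) ∎
  where
  open ℚₚ.≤-Reasoning
  wⁿ≤vⁿ : w ^ n ≤ suc x ^ n
  wⁿ≤vⁿ = ℕₚ.^-monoˡ-≤ n (subst (w ≤_) eq (ℕₚ.m≤m+n w t))
  lower : fromℕ n ℚ.* (fromℕ t ℚ.* r x) ℚ.≤ between (w ^ n) (suc x ^ n)
  lower = subst₂ (λ a c → fromℕ n ℚ.* (fromℕ t ℚ.* r x) ℚ.≤ between a c) (ℕₚ.*-identityʳ (w ^ n)) (ℕₚ.*-identityʳ (suc x ^ n))
            (between-^-≥ n 1 0<w (s≤s z≤n) eq)
  half : r 1 ℚ.≤ between (suc x ^ n) (2 * suc x ^ n)
  half = subst (λ a → r 1 ℚ.≤ between a (2 * suc x ^ n)) (ℕₚ.*-identityˡ (suc x ^ n))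
           (between-≥ {1} {1} {1} (suc x ^ n) (ℕₚ.m^n>0 (suc x) n) refl)

-- If the conclusion failed, `logSum-≥` would bound 2 log v below by 2dn/v + 1/2 up to an error
-- tending to 0. Then (v/d) log v would exceed n, against the upper half of the ceiling condition.
power-bound : ∀ {v d w} n .{{_ : ℕ.NonZero d}} → 0 < w → w + 2 * d ≡ v →
              (+ v / d) · log v ≤ʳ fromℤ (+ n) → v ^ 2 * w ^ n < 2 * v ^ n
power-bound {zero}  {suc d} {suc w} n _   () _
power-bound {suc x} {d@(suc d′)} {w} n 0<w eq ceil = ℕₚ.≰⇒> λ le →
  -- Multiplication by c/2 turns the 1/2 into c/4 = 2ε. From index 7 on, the error c/(N+1) is at
  -- most c/8 = ε, so a gap of ε remains.
  ceil (ε , ℚₚ.positive⁻¹ ε {{εpos}} , 7 , λ N 7≤N → +-cancelʳ-≤ ε (begin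
    fromℕ n ℚ.+ ε ℚ.+ ε                                  ≡⟨ identity ⟨
    c ℚ.* (r 1 ℚ.* (fromℕ n ℚ.* (fromℕ (2 * d) ℚ.* r x) ℚ.+ r 1)) ≤⟨ ℚₚ.*-monoˡ-≤-nonNeg c (ℚₚ.*-monoˡ-≤-nonNeg (r 1) (logSum-≥ {n = n} 0<w eq le N)) ⟩
    c ℚ.* (r 1 ℚ.* ((r N ℚ.+ L N) ℚ.+ (r N ℚ.+ L N)))    ≡⟨ cong (c ℚ.*_) (halve (r N ℚ.+ L N)) ⟩
    c ℚ.* (r N ℚ.+ L N)                                  ≤⟨ ℚₚ.*-monoˡ-≤-nonNeg c (ℚₚ.+-monoˡ-≤ (L N) (r-anti 7≤N)) ⟩
    c ℚ.* (r 7 ℚ.+ L N)                                  ≡⟨ ℚₚ.*-distribˡ-+ c (r 7) (L N) ⟩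
    ε ℚ.+ c ℚ.* L N                                      ≡⟨ ℚₚ.+-comm ε (c ℚ.* L N) ⟩
    c ℚ.* L N ℚ.+ ε                                      ∎))
  where
  open ℚₚ.≤-Reasoning
  L = logSum (suc x)
  c = + suc x / d
  ε = c ℚ.* r 7
  instance
    cpos : ℚ.Positive c
    cpos = ℚₚ.normalize-pos (suc x) d
    cnonNeg : ℚ.NonNegative c
    cnonNeg = ℚₚ.pos⇒nonNeg c
  εpos : ℚ.Positive ε
  εpos = ℚₚ.pos*pos⇒pos c (r 7)
  halve : ∀ y → r 1 ℚ.* (y ℚ.+ y) ≡ y
  halve y = let open +-*-Solver in solve 1 (λ y → con (r 1) :* (y :+ y) := y) refl y
  identity : c ℚ.* (r 1 ℚ.* (fromℕ n ℚ.* (fromℕ (2 * d) ℚ.* r x) ℚ.+ r 1)) ≡ fromℕ n ℚ.+ ε ℚ.+ ε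
  identity = begin-equality
    c ℚ.* (r 1 ℚ.* (fromℕ n ℚ.* (fromℕ (2 * d) ℚ.* r x) ℚ.+ r 1))
      ≡⟨ cong₂ (λ p q → p ℚ.* (r 1 ℚ.* (fromℕ n ℚ.* (q ℚ.* r x) ℚ.+ r 1))) (/-as-* (suc x) d′) (fromℕ-* 2 d) ⟩
    (V ℚ.* r d′) ℚ.* (r 1 ℚ.* (fromℕ n ℚ.* ((fromℕ 2 ℚ.* D) ℚ.* r x) ℚ.+ r 1))
      ≡⟨ (let open +-*-Solver in solve 5 (λ V rd n D rx →
           (V :* rd) :* (con (r 1) :* (n :* ((con (fromℕ 2) :* D) :* rx) :+ con (r 1))) :=
           n :* ((V :* rx) :* (D :* rd)) :+ (V :* rd) :* con (r 7) :+ (V :* rd) :* con (r 7)) refl V (r d′) (fromℕ n) D (r x)) ⟩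
    fromℕ n ℚ.* ((V ℚ.* r x) ℚ.* (D ℚ.* r d′)) ℚ.+ (V ℚ.* r d′) ℚ.* r 7 ℚ.+ (V ℚ.* r d′) ℚ.* r 7
      ≡⟨ cong₂ (λ p q → fromℕ n ℚ.* p ℚ.+ q ℚ.* r 7 ℚ.+ q ℚ.* r 7) (cong₂ ℚ._*_ (fromℕ-*-r x) (fromℕ-*-r d′)) (sym (/-as-* (suc x) d′)) ⟩
    fromℕ n ℚ.* 1ℚ ℚ.+ ε ℚ.+ ε
      ≡⟨ cong (λ p → p ℚ.+ ε ℚ.+ ε) (ℚₚ.*-identityʳ (fromℕ n)) ⟩
    fromℕ n ℚ.+ ε ℚ.+ ε ∎
    where
    V = fromℕ (suc x)
    D = fromℕ d

-- Upper bounds for log v.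

LogBelow : ℕ → ℕ → Set
LogBelow v d = ∀ N → logSum v N ℚ.≤ fromℕ d

-- The right side is the upper Darboux sum of mesh 1/(M+1), and a common refinement puts every lower
-- sum below it. A single finite sum thus bounds `logSum v N` for all `N`.
logSum-≤-harm : ∀ v N M → logSum v N ℚ.≤ harm M ((v ∸ 1) * suc M)
logSum-≤-harm v N M = ℚₚ.≤-trans (refine-lower (suc N) (p * suc N) M)
  (ℚₚ.≤-trans (ℚₚ.≤-reflexive (cong₂ harm (ℕₚ.*-comm (suc N) (suc M)) (nat p N M)))
    (refine-upper M (p * suc M) N))
  where
  p = v ∸ 1
  nat : ∀ p N M → p * suc N * suc M ≡ p * suc M * suc N
  nat = solve-∀

-- This case, (l , g) = (3 , 2), and the next two, (1 , 4) and (2 , 3), start the inductions. Each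
-- evaluates one upper sum, of the coarsest mesh 1/(M+1) for which it is small enough.
logBelow-12 : LogBelow 12 3
logBelow-12 N = ℚₚ.≤-trans (logSum-≤-harm 12 N 1) (from-yes (harm 1 22 ℚₚ.≤? fromℕ 3))

logBelow-16 : LogBelow 16 3
logBelow-16 N = ℚₚ.≤-trans (logSum-≤-harm 16 N 2) (from-yes (harm 2 45 ℚₚ.≤? fromℕ 3))

logBelow-18 : LogBelow 18 4
logBelow-18 N = ℚₚ.≤-trans (logSum-≤-harm 18 N 0) (from-yes (harm 0 17 ℚₚ.≤? fromℕ 4))

-- log (1 + m/v) ≤ m/v ≤ e
logBelow-+ : ∀ {v d m e} → 0 < v → m ≤ e * v → LogBelow v d → LogBelow (v + m) (d + e)
logBelow-+ {suc x} {d} {m} {e} _ m≤ev below N = begin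
  harm (suc N) ((x + m) * suc N)                         ≡⟨ cong (harm (suc N)) (ℕₚ.*-distribʳ-+ (suc N) x m) ⟩
  harm (suc N) (x * suc N + m * suc N)                   ≡⟨ harm-+ (suc N) (x * suc N) (m * suc N) ⟩
  logSum (suc x) N ℚ.+ harm (suc x * suc N) (m * suc N)    ≤⟨ ℚₚ.+-mono-≤ (below N) (harm-≤ x m N) ⟩
  fromℕ d ℚ.+ fromℕ m ℚ.* r x                              ≤⟨ ℚₚ.+-monoʳ-≤ (fromℕ d) (ℚₚ.*-monoʳ-≤-nonNeg (r x) {{r-nonNeg x}} (fromℕ-mono-≤ m≤ev)) ⟩
  fromℕ d ℚ.+ fromℕ (e * suc x) ℚ.* r x                    ≡⟨ cong (λ t → fromℕ d ℚ.+ t ℚ.* r x) (fromℕ-* e (suc x)) ⟩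
  fromℕ d ℚ.+ fromℕ e ℚ.* fromℕ (suc x) ℚ.* r x            ≡⟨ cong (fromℕ d ℚ.+_) (ℚₚ.*-assoc (fromℕ e) (fromℕ (suc x)) (r x)) ⟩
  fromℕ d ℚ.+ fromℕ e ℚ.* (fromℕ (suc x) ℚ.* r x)          ≡⟨ cong (λ t → fromℕ d ℚ.+ fromℕ e ℚ.* t) (fromℕ-*-r x) ⟩
  fromℕ d ℚ.+ fromℕ e ℚ.* 1ℚ                               ≡⟨ cong (fromℕ d ℚ.+_) (ℚₚ.*-identityʳ (fromℕ e)) ⟩
  fromℕ d ℚ.+ fromℕ e                                      ≡⟨ fromℕ-+ d e ⟨
  fromℕ (d + e)                                          ∎
  where open ℚₚ.≤-Reasoning

-- With g = h + 1, one more in l adds g² to l g² and h to l h; `logBelow-+` applies because g² ≤ h ·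
-- l g².
logBelow-sucˡ : ∀ {l h} → 1 ≤ l → 1 ≤ h → LogBelow (l * (suc h * suc h)) (l * h) →
                LogBelow (suc l * (suc h * suc h)) (suc l * h)
logBelow-sucˡ {l} {h} 1≤l 1≤h below = subst₂ LogBelow (ℕₚ.+-comm (l * q) q) (ℕₚ.+-comm (l * h) h)
  (logBelow-+ {l * q} {l * h} {q} {h} (ℕₚ.*-mono-≤ 1≤l (s≤s z≤n))
    (subst (_≤ h * (l * q)) (trans (ℕₚ.*-identityˡ _) (ℕₚ.*-identityˡ q)) (ℕₚ.*-mono-≤ 1≤h (ℕₚ.*-monoˡ-≤ q 1≤l)))
    below)
  where q = suc h * suc h

logBelow-+ˡ : ∀ {l h} i → 1 ≤ l → 1 ≤ h → LogBelow (l * (suc h * suc h)) (l * h) →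
              LogBelow ((i + l) * (suc h * suc h)) ((i + l) * h)
logBelow-+ˡ         zero    1≤l 1≤h below = below
logBelow-+ˡ {l} {h} (suc i) 1≤l 1≤h below =
  logBelow-sucˡ {i + l} {h} (ℕₚ.≤-trans 1≤l (ℕₚ.m≤n+m l i)) 1≤h (logBelow-+ˡ {l} {h} i 1≤l 1≤h below)

-- The increment l(2g+1) of l g² has to be at most l · l g², where g = h + 1.
logBelow-sucʳ : ∀ {l h} → 1 ≤ l → 2 * suc h + 1 ≤ l * (suc h * suc h) →
                LogBelow (l * (suc h * suc h)) (l * h) → LogBelow (l * (suc (suc h) * suc (suc h))) (l * suc h)
logBelow-sucʳ {l} {h} 1≤l le below = subst₂ LogBelow (nat₁ l (suc h)) (nat₂ l h)
  (logBelow-+ {l * q} {l * h} {l * (2 * suc h + 1)} {l} (ℕₚ.*-mono-≤ 1≤l (s≤s z≤n)) (ℕₚ.*-monoʳ-≤ l le) below)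
  where
  q = suc h * suc h
  nat₁ : ∀ l g → l * (g * g) + l * (2 * g + 1) ≡ l * (suc g * suc g)
  nat₁ = solve-∀
  nat₂ : ∀ l h → l * h + l ≡ l * suc h
  nat₂ = solve-∀

-- The condition 2g + 1 ≤ l g² has to be known only at the start: from g to g + 1 its left side
-- grows by 2 and its right side by l(2g + 1).
logBelow-+ʳ : ∀ {l h} j → 1 ≤ l → 2 * suc h + 1 ≤ l * (suc h * suc h) →
              LogBelow (l * (suc h * suc h)) (l * h) → LogBelow (l * (suc (j + h) * suc (j + h))) (l * (j + h))
logBelow-+ʳ {l} {h} zero    1≤l le below = below
logBelow-+ʳ {l} {h} (suc j) 1≤l le below =
  subst (λ t → LogBelow (l * (suc t * suc t)) (l * t)) (ℕₚ.+-suc j h)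
    (logBelow-+ʳ {l} {suc h} j 1≤l le′ (logBelow-sucʳ {l} {h} 1≤l le below))
  where
  nat₁ : ∀ g → 2 * g + 1 + 2 ≡ 2 * suc g + 1
  nat₁ = solve-∀
  nat₂ : ∀ l h → l * (suc h * suc h) + l * (2 + (2 * h + 1)) ≡ l * (suc (suc h) * suc (suc h))
  nat₂ = solve-∀
  le′ : 2 * suc (suc h) + 1 ≤ l * (suc (suc h) * suc (suc h))
  le′ = subst₂ _≤_ (nat₁ (suc h)) (nat₂ l h)
    (ℕₚ.+-mono-≤ le (ℕₚ.*-mono-≤ {1} {l} {2} 1≤l (ℕₚ.m≤m+n 2 (2 * h + 1))))

-- For l = 1 and l = 2 only g grows, from 4 and 3. For l ≥ 3 first l grows from 3 at g = 2, then g
-- grows.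
logBelow-design : ∀ l h → 1 ≤ l → 1 ≤ h → (l , suc h) ∉ ((1 , 2) ∷ (1 , 3) ∷ (2 , 2) ∷ []) →
                  LogBelow (l * (suc h * suc h)) (l * h)
logBelow-design 1 1 _ _ ∉ = contradiction (here refl) ∉
logBelow-design 1 2 _ _ ∉ = contradiction (there (here refl)) ∉
logBelow-design 2 1 _ _ ∉ = contradiction (there (there (here refl))) ∉
logBelow-design 1 (suc (suc (suc j))) _ _ _ = subst (λ t → LogBelow (1 * (suc t * suc t)) (1 * t)) (ℕₚ.+-comm j 3)
  (logBelow-+ʳ {1} {3} j (s≤s z≤n) (ℕₚ.m≤m+n 9 7) logBelow-16)
logBelow-design 2 (suc (suc j)) _ _ _ = subst (λ t → LogBelow (2 * (suc t * suc t)) (2 * t)) (ℕₚ.+-comm j 2)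
  (logBelow-+ʳ {2} {2} j (s≤s z≤n) (ℕₚ.m≤m+n 7 11) logBelow-18)
logBelow-design (suc (suc (suc i))) (suc j) _ _ _ =
  subst₂ (λ s t → LogBelow (s * (suc t * suc t)) (s * t)) (ℕₚ.+-comm i 3) (ℕₚ.+-comm j 1)
    (logBelow-+ʳ {i + 3} {1} j (ℕₚ.m≤n⇒m≤o+n i (s≤s z≤n))
      (ℕₚ.≤-trans (ℕₚ.m≤m+n 5 7) (ℕₚ.*-monoˡ-≤ 4 (ℕₚ.m≤n+m 3 i)))
      (logBelow-+ˡ {3} {1} i (s≤s z≤n) (s≤s z≤n) logBelow-12))

-- From log v ≤ d follows (v/d) log v ≤ v, hence n - 1 < v. This leaves room for a set of exactly n
-- among v blocks.
ceiling-≤ : ∀ {v d n} .{{_ : ℕ.NonZero d}} → LogBelow v d → fromℤ (+ n ℤ.- + 1) <ʳ ((+ v / d) · log v) → n ≤ v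
ceiling-≤ {n = zero} _ _ = z≤n
ceiling-≤ {v} {d@(suc d′)} {suc m} below (ε , 0<ε , N , h) = ℕₚ.≰⇒> λ v≤m → ℚₚ.<-irrefl refl (begin-strict
  fromℕ v                       ≤⟨ fromℕ-mono-≤ v≤m ⟩
  fromℕ m                       ≡⟨ ℚₚ.+-identityʳ (fromℕ m) ⟨
  fromℕ m ℚ.+ 0ℚ                <⟨ ℚₚ.+-monoʳ-< (fromℕ m) 0<ε ⟩
  fromℕ m ℚ.+ ε                 ≤⟨ h N ℕₚ.≤-refl ⟩
  (+ v / d) ℚ.* logSum v N      ≤⟨ ℚₚ.*-monoˡ-≤-nonNeg (+ v / d) {{ℚₚ.normalize-nonNeg v d}} (below N) ⟩
  (+ v / d) ℚ.* fromℕ d         ≡⟨ cong (ℚ._* fromℕ d) (/-as-* v d′) ⟩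
  fromℕ v ℚ.* r d′ ℚ.* fromℕ d  ≡⟨ ℚₚ.*-assoc (fromℕ v) (r d′) (fromℕ d) ⟩
  fromℕ v ℚ.* (r d′ ℚ.* fromℕ d) ≡⟨ cong (fromℕ v ℚ.*_) (trans (ℚₚ.*-comm (r d′) (fromℕ d)) (fromℕ-*-r d′)) ⟩
  fromℕ v ℚ.* 1ℚ                ≡⟨ ℚₚ.*-identityʳ (fromℕ v) ⟩
  fromℕ v                       ∎)
  where open ℚₚ.≤-Reasoning

-- Counting in subsets and the greedy choice

#_ : Bool → ℕ
# true  = 1
# false = 0

infix 9 #_

∣p∣≡sum : ∀ {n} (p : Subset n) → ∣ p ∣ ≡ sum (λ i → # lookup p i)
∣p∣≡sum []            = refl
∣p∣≡sum (inside  ∷ p) = cong suc (∣p∣≡sum p)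
∣p∣≡sum (outside ∷ p) = ∣p∣≡sum p

#-∧ : ∀ a b → # (a ∧ b) ≡ # a * # b
#-∧ true  b = sym (ℕₚ.*-identityˡ (# b))
#-∧ false b = refl

∣p∩q∣≡sum : ∀ {n} (p q : Subset n) → ∣ p ∩ q ∣ ≡ sum (λ i → # lookup p i * # lookup q i)
∣p∩q∣≡sum p q = trans (∣p∣≡sum (p ∩ q)) (sum-cong-≗ λ i →
  trans (cong #_ (lookup-zipWith _∧_ i p q)) (#-∧ (lookup p i) (lookup q i)))

sum-const : ∀ n c → sum {n} (λ _ → c) ≡ n * c
sum-const zero    c = refl
sum-const (suc n) c = cong (c ℕ.+_) (sum-const n c)

∃-below-average : ∀ {n} (f : Fin (suc n) → ℕ) → ∃ λ i → suc n * f i ≤ sum f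
∃-below-average {zero}  f = zero , ℕₚ.≤-refl
∃-below-average {suc n} f with ∃-below-average (f ∘ suc)
... | i , le with ℕₚ.≤-total (f zero) (f (suc i))
...   | inj₁ f0≤fi = zero , ℕₚ.+-monoʳ-≤ (f zero) (ℕₚ.≤-trans (ℕₚ.*-monoʳ-≤ (suc n) f0≤fi) le)
...   | inj₂ fi≤f0 = suc i , ℕₚ.+-mono-≤ fi≤f0 le

∣p∪q∣≤∣p∣+∣q∣ : ∀ {n} (p q : Subset n) → ∣ p ∪ q ∣ ≤ ∣ p ∣ + ∣ q ∣
∣p∪q∣≤∣p∣+∣q∣ []            []            = z≤n
∣p∪q∣≤∣p∣+∣q∣ (inside  ∷ p) (inside  ∷ q) = s≤s (ℕₚ.≤-trans (∣p∪q∣≤∣p∣+∣q∣ p q) (ℕₚ.+-monoʳ-≤ ∣ p ∣ (ℕₚ.n≤1+n ∣ q ∣)))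
∣p∪q∣≤∣p∣+∣q∣ (inside  ∷ p) (outside ∷ q) = s≤s (∣p∪q∣≤∣p∣+∣q∣ p q)
∣p∪q∣≤∣p∣+∣q∣ (outside ∷ p) (inside  ∷ q) = subst (suc ∣ p ∪ q ∣ ≤_) (sym (ℕₚ.+-suc ∣ p ∣ ∣ q ∣)) (s≤s (∣p∪q∣≤∣p∣+∣q∣ p q))
∣p∪q∣≤∣p∣+∣q∣ (outside ∷ p) (outside ∷ q) = ∣p∪q∣≤∣p∣+∣q∣ p q

extend : ∀ {m} (p : Subset m) n → ∣ p ∣ ≤ n → n ≤ m → ∃ λ q → p ⊆ q × ∣ q ∣ ≡ n
extend []            zero    _         _         = [] , id , refl
extend (inside ∷ p)  (suc n) (s≤s p≤n) (s≤s n≤m) with extend p n p≤n n≤m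
... | q , p⊆q , eq = inside ∷ q , in⊆in p⊆q , cong suc eq
extend {suc m} (outside ∷ p) n p≤n n≤1+m with ℕₚ.m≤n⇒m<n∨m≡n n≤1+m
... | inj₂ refl = ⊤ , ⊆⊤ , ∣⊤∣≡n (suc m)
... | inj₁ (s≤s n≤m) with extend p n p≤n n≤m
...   | q , p⊆q , eq = outside ∷ q , out⊆ p⊆q , eq

∃-other : ∀ {n} → 2 ≤ n → (i : Fin n) → ∃ λ j → i ≢ j
∃-other (s≤s (s≤s _)) zero    = suc zero , λ()
∃-other (s≤s (s≤s _)) (suc i) = zero , λ()

nonempty : ∀ {n} {p : Subset n} → 0 < ∣ p ∣ → Nonempty p
nonempty {n} {p} 0<∣p∣ with nonempty? p
... | yes ne = ne
... | no  ¬ne rewrite Empty-unique ¬ne | ∣⊥∣≡0 n = contradiction 0<∣p∣ λ()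

∣p∣≡1⇒unique : ∀ {n} {p : Subset n} {x y} → ∣ p ∣ ≡ 1 → x ∈ p → y ∈ p → x ≡ y
∣p∣≡1⇒unique {p = p} {x} {y} eq x∈p y∈p with x ≟ y
... | yes x≡y = x≡y
... | no  x≢y = contradiction (ℕₚ.≤-trans (s≤s 0<∣p-x∣) (subst (∣ p - x ∣ <_) eq (x∈p⇒∣p-x∣<∣p∣ x∈p))) λ where (s≤s ())
  where
  0<∣p-x∣ : 0 < ∣ p - x ∣
  0<∣p-x∣ = ℕₚ.≤-<-trans z≤n (x∈p⇒∣p-x∣<∣p∣ (x∈p∧x≢y⇒x∈p-y y∈p (x≢y ∘ sym)))

module _ {A : Set} {b : ℕ} (misses : Fin b → A → Bool) where

  -- Double counting of the pairs of an index and an element it misses, regrouped by the element.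
  sum-length-filter : ∀ w xs → All (λ a → sum (λ j → # misses j a) ≤ w) xs →
                      sum (λ j → length (filterᵇ (misses j) xs)) ≤ length xs * w
  sum-length-filter w []       []       = ℕₚ.≤-reflexive (trans (sum-const b 0) (ℕₚ.*-zeroʳ b))
  sum-length-filter w (a ∷ xs) (h ∷ hs) = begin
    sum (λ j → length (filterᵇ (misses j) (a ∷ xs)))             ≡⟨ sum-cong-≗ (λ j → split j) ⟩
    sum (λ j → # misses j a + length (filterᵇ (misses j) xs))    ≡⟨ ∑-distrib-+ (λ j → # misses j a) _ ⟩
    sum (λ j → # misses j a) + sum (λ j → length (filterᵇ (misses j) xs)) ≤⟨ ℕₚ.+-mono-≤ h (sum-length-filter w xs hs) ⟩
    w + length xs * w                                            ∎
    where
    open ℕₚ.≤-Reasoning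
    split : ∀ j → length (filterᵇ (misses j) (a ∷ xs)) ≡ # misses j a + length (filterᵇ (misses j) xs)
    split j with misses j a
    ... | true  = refl
    ... | false = refl

  HitBy : Subset b → A → Set
  HitBy S a = ∃ λ j → j ∈ S × misses j a ≡ false

  -- An element removed by the filter is hit by `j` itself; the others are hit by `S`.
  hitBy-filter : ∀ {S S′} j xs → j ∈ S′ → S ⊆ S′ → All (HitBy S) (filterᵇ (misses j) xs) → All (HitBy S′) xs
  hitBy-filter j []       _  _   _ = []
  hitBy-filter j (a ∷ xs) j∈ S⊆ hs with misses j a in eq
  hitBy-filter j (a ∷ xs) j∈ S⊆ ((i , i∈ , hit) ∷ hs) | true = (i , S⊆ i∈ , hit) ∷ hitBy-filter j xs j∈ S⊆ hs
  ... | false = (j , j∈ , eq) ∷ hitBy-filter j xs j∈ S⊆ hs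

-- Choose, at each step, an index missing at most the fraction w/b of the remaining elements.
greedy : ∀ {A : Set} {b} (misses : Fin b → A → Bool) w n xs → All (λ a → sum (λ j → # misses j a) ≤ w) xs →
         length xs * w ^ n < b ^ n → ∃ λ S → ∣ S ∣ ≤ n × All (HitBy misses S) xs
-- For n = 0 the bound says `length xs < 1`, so nothing is left to hit.
greedy {b = b} misses w zero [] _ _ = ∅ , ℕₚ.≤-reflexive (∣⊥∣≡0 b) , []
greedy misses w zero (x ∷ xs) _ (s≤s ())
greedy {b = suc b} misses w (suc n) xs h lt with ∃-below-average (λ j → length (filterᵇ (misses j) xs))
... | j , le with greedy misses w n (filterᵇ (misses j) xs) (Allₚ.filter⁺ _ h) lt′
  where
  L = length (filterᵇ (misses j) xs)
  nat : ∀ x w p → x * w * p ≡ x * (w * p)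
  nat = solve-∀
  lt′ : L * w ^ n < suc b ^ n
  -- The choice of `j` gives `suc b * L ≤ length xs * w`: one factor `w` is spent, and one factor
  -- `suc b` cancels.
  lt′ = ℕₚ.*-cancelˡ-< (suc b) _ _ (begin-strict
    suc b * (L * w ^ n)      ≡⟨ ℕₚ.*-assoc (suc b) L (w ^ n) ⟨
    suc b * L * w ^ n        ≤⟨ ℕₚ.*-monoˡ-≤ (w ^ n) (ℕₚ.≤-trans le (sum-length-filter misses w xs h)) ⟩
    length xs * w * w ^ n    ≡⟨ nat (length xs) w (w ^ n) ⟩
    length xs * w ^ suc n    <⟨ lt ⟩
    suc b ^ suc n            ∎)
    where open ℕₚ.≤-Reasoning
...   | S , ∣S∣≤n , hits = ⁅ j ⁆ ∪ S , ∣∣≤ ,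
          hitBy-filter misses j xs (x∈p∪q⁺ (inj₁ (x∈⁅x⁆ j))) (q⊆p∪q ⁅ j ⁆ S) hits
  where
  ∣∣≤ : ∣ ⁅ j ⁆ ∪ S ∣ ≤ suc n
  ∣∣≤ = ℕₚ.≤-trans (∣p∪q∣≤∣p∣+∣q∣ ⁅ j ⁆ S) (ℕₚ.+-mono-≤ (ℕₚ.≤-reflexive (∣⁅x⁆∣≡1 j)) ∣S∣≤n)

-- Unordered pairs.

pairs : ∀ {A : Set} → List A → List (A × A)
pairs []       = []
pairs (x ∷ xs) = map (x ,_) xs ++ pairs xs

2*length-pairs : ∀ {A : Set} (xs : List A) → 2 * length (pairs xs) ≤ length xs ^ 2
2*length-pairs []       = z≤n
2*length-pairs (x ∷ xs) = begin
  2 * length (map (x ,_) xs ++ pairs xs)   ≡⟨ cong (2 *_) (trans (length-++ (map (x ,_) xs)) (cong (_+ length (pairs xs)) (length-map (x ,_) xs))) ⟩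
  2 * (n + length (pairs xs))              ≡⟨ ℕₚ.*-distribˡ-+ 2 n _ ⟩
  2 * n + 2 * length (pairs xs)            ≤⟨ ℕₚ.+-monoʳ-≤ (2 * n) (2*length-pairs xs) ⟩
  2 * n + n ^ 2                            ≤⟨ ℕₚ.n≤1+n _ ⟩
  suc (2 * n + n ^ 2)                      ≡⟨ nat n ⟩
  suc n ^ 2                                ∎
  where
  open ℕₚ.≤-Reasoning
  n = length xs
  nat : ∀ n → suc (2 * n + n * (n * 1)) ≡ suc n * (suc n * 1)
  nat = solve-∀

pairs⁺ : ∀ {A : Set} {R : A → A → Set} {xs} → AllPairs R xs → All (uncurry R) (pairs xs)
pairs⁺ []       = []
pairs⁺ (h ∷ hs) = Allₚ.++⁺ (Allₚ.map⁺ h) (pairs⁺ hs)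

-- Two entries are paired only in the order of the list, so `R` is obtained in one of the two
-- directions.
pairs⁻ : ∀ {A : Set} {R : A → A → Set} xs → All (uncurry R) (pairs xs) →
         ∀ {x y} → x ∈ₗ xs → y ∈ₗ xs → x ≢ y → R x y ⊎ R y x
pairs⁻ {R = R} (z ∷ zs) hs = go
  where
  h₁ : All (R z) zs
  h₁ = Allₚ.map⁻ (Allₚ.++⁻ˡ (map (z ,_) zs) hs)
  go : ∀ {x y} → x ∈ₗ z ∷ zs → y ∈ₗ z ∷ zs → x ≢ y → R x y ⊎ R y x
  go (here refl) (here refl) x≢y = contradiction refl x≢y
  go (here refl) (there y∈)  _   = inj₁ (All.lookup h₁ y∈)
  go (there x∈)  (here refl) _   = inj₂ (All.lookup h₁ x∈)
  go (there x∈)  (there y∈)  x≢y = pairs⁻ zs (Allₚ.++⁻ʳ (map (z ,_) zs) hs) x∈ y∈ x≢y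

-- Separation of points by blocks, and distances in the incidence graph.

module _ {v b : ℕ} (B : Fin b → Subset v) where

  lookup-dual : ∀ x j → lookup (dual B x) j ≡ lookup (B j) x
  lookup-dual x j = lookup∘tabulate (λ j → lookup (B j) x) j

  ∈-dual⁻ : ∀ {x j} → j ∈ dual B x → x ∈ B j
  ∈-dual⁻ {x} {j} j∈ = lookup⇒[]= x (B j) (trans (sym (lookup-dual x j)) ([]=⇒lookup j∈))

  -- The instance of `misses` for `greedy`: a block misses a pair of points when it contains both or
  -- neither.
  agrees : Fin b → Fin v × Fin v → Bool
  agrees j (x , y) = not (lookup (B j) x xor lookup (B j) y)

  disagrees⇒one : ∀ j x y → agrees j (x , y) ≡ false → ContainsExactlyOne (B j) x y
  disagrees⇒one j x y eq with lookup (B j) x in ex | lookup (B j) y in ey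
  ... | true  | false = inj₁ (lookup⇒[]= x (B j) ex , λ y∈ → contradiction (trans (sym ey) ([]=⇒lookup y∈)) λ())
  ... | false | true  = inj₂ ((λ x∈ → contradiction (trans (sym ex) ([]=⇒lookup x∈)) λ()) , lookup⇒[]= y (B j) ey)
  disagrees⇒one j x y () | true | true
  disagrees⇒one j x y () | false | false

  -- For indicators X and Y, that of "both or neither" is 1 - X - Y + 2XY. Summed over the blocks,
  -- with the negative terms moved to the left.
  sum-agrees : ∀ x y → sum (λ j → # agrees j (x , y)) + (∣ dual B x ∣ + ∣ dual B y ∣) ≡ b + 2 * ∣ dual B x ∩ dual B y ∣
  sum-agrees x y = begin
    sum m + (∣ dual B x ∣ + ∣ dual B y ∣)         ≡⟨ cong₂ (λ p q → sum m + (p + q)) (∣p∣≡sum (dual B x)) (∣p∣≡sum (dual B y)) ⟩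
    sum m + (sum X + sum Y)                       ≡⟨ cong (sum m ℕ.+_) (∑-distrib-+ X Y) ⟨
    sum m + sum (λ j → X j + Y j)                 ≡⟨ ∑-distrib-+ m (λ j → X j + Y j) ⟨
    sum (λ j → m j + (X j + Y j))                 ≡⟨ sum-cong-≗ pointwise ⟩
    sum (λ j → 1 + 2 * (X j * Y j))               ≡⟨ ∑-distrib-+ {b} (λ _ → 1) (λ j → 2 * (X j * Y j)) ⟩
    sum {b} (λ _ → 1) + sum (λ j → 2 * (X j * Y j)) ≡⟨ cong₂ _+_ (trans (sum-const b 1) (ℕₚ.*-identityʳ b)) (sym (*-distribˡ-sum 2 (λ j → X j * Y j))) ⟩
    b + 2 * sum (λ j → X j * Y j)                 ≡⟨ cong (λ t → b + 2 * t) (∣p∩q∣≡sum (dual B x) (dual B y)) ⟨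
    b + 2 * ∣ dual B x ∩ dual B y ∣               ∎
    where
    open ≡-Reasoning
    m X Y : Fin b → ℕ
    m j = # agrees j (x , y)
    X j = # lookup (dual B x) j
    Y j = # lookup (dual B y) j
    pointwise : ∀ j → m j + (X j + Y j) ≡ 1 + 2 * (X j * Y j)
    pointwise j rewrite lookup-dual x j | lookup-dual y j with lookup (B j) x | lookup (B j) y
    ... | true  | true  = refl
    ... | true  | false = refl
    ... | false | true  = refl
    ... | false | false = refl

  open IncidenceGraph B

  distance-unique : ∀ {u w d d′} → IsDistance u w d → IsDistance u w d′ → d ≡ d′
  distance-unique (p , min) (p′ , min′) = ℕₚ.≤-antisym (min p′) (min′ p)

  distance-∈ : ∀ {j x} → x ∈ B j → IsDistance (inj₂ j) (inj₁ x) 1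
  distance-∈ x∈ = x∈ ∷ [] , λ where (_ ∷ _) → s≤s z≤n

  module _ {l k g : ℕ} (D : SymmetricTransversalDesign l k g B) where
    open SymmetricTransversalDesign D
    open TransversalDesign design

    ∣dual∣≡k : ∀ x → ∣ dual B x ∣ ≡ k
    ∣dual∣≡k = TransversalDesign.block-size dual-design

    -- Count the pairs (y , j) with y in the class i and x, y in the block j.
    k≡l*g : 2 ≤ k → Fin v → k ≡ l * g
    k≡l*g 2≤k x with partition x
    ... | i₀ , x∈ , _ with ∃-other 2≤k i₀
    ... | i , i₀≢i = begin
      k                                                   ≡⟨ ∣dual∣≡k x ⟨
      ∣ dual B x ∣                                        ≡⟨ ∣p∣≡sum (dual B x) ⟩
      sum X                                               ≡⟨ sum-cong-≗ (λ j → trans (cong (X j *_) (transversal j i)) (ℕₚ.*-identityʳ (X j))) ⟨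
      sum (λ j → X j * ∣ B j ∩ G i ∣)                     ≡⟨ sum-cong-≗ (λ j → trans (cong (X j *_) (∣p∩q∣≡sum (B j) (G i))) (*-distribˡ-sum (X j) (λ y → # lookup (B j) y * C y))) ⟩
      sum (λ j → sum (λ y → X j * (# lookup (B j) y * C y))) ≡⟨ ∑-comm (λ j y → X j * (# lookup (B j) y * C y)) ⟩
      sum (λ y → sum (λ j → X j * (# lookup (B j) y * C y))) ≡⟨ sum-cong-≗ (λ y → sum-cong-≗ (λ j → trans (nat (X j) (# lookup (B j) y) (C y))
                                                                 (cong (λ t → C y * (X j * # t)) (sym (lookup-dual y j))))) ⟩
      sum (λ y → sum (λ j → C y * (X j * # lookup (dual B y) j))) ≡⟨ sum-cong-≗ (λ y → trans (cong (C y *_) (∣p∩q∣≡sum (dual B x) (dual B y))) (*-distribˡ-sum (C y) (λ j → X j * # lookup (dual B y) j))) ⟨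
      sum (λ y → C y * ∣ dual B x ∩ dual B y ∣)           ≡⟨ sum-cong-≗ (λ y → class y) ⟩
      sum (λ y → l * C y)                                 ≡⟨ *-distribˡ-sum l C ⟨
      l * sum C                                           ≡⟨ cong (l *_) (∣p∣≡sum (G i)) ⟨
      l * ∣ G i ∣                                         ≡⟨ cong (l *_) (class-size i) ⟩
      l * g                                               ∎
      where
      open ≡-Reasoning
      X : Fin b → ℕ
      X j = # lookup (dual B x) j
      C : Fin v → ℕ
      C y = # lookup (G i) y
      nat : ∀ a b c → a * (b * c) ≡ c * (a * b)
      nat = solve-∀
      class : ∀ y → C y * ∣ dual B x ∩ dual B y ∣ ≡ l * C y
      class y with lookup (G i) y in eq
      ... | true  = trans (ℕₚ.*-identityˡ _) (trans (balanced x∈ (lookup⇒[]= y (G i) eq) i₀≢i) (sym (ℕₚ.*-identityʳ l)))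
      ... | false = sym (ℕₚ.*-zeroʳ l)

    -- Distinct points of one class share no block, since a block meets each class exactly once.
    ∣dual∩dual∣≤l : ∀ {x y} → x ≢ y → ∣ dual B x ∩ dual B y ∣ ≤ l
    ∣dual∩dual∣≤l {x} {y} x≢y with partition x | partition y
    ... | i , x∈ , _ | i′ , y∈ , _ with i ≟ i′
    ...   | no  i≢i′ = ℕₚ.≤-reflexive (balanced x∈ y∈ i≢i′)
    ...   | yes refl = subst (_≤ l) (sym (trans (cong ∣_∣ (Empty-unique disjoint)) (∣⊥∣≡0 b))) z≤n
      where
      disjoint : ¬ Nonempty (dual B x ∩ dual B y)
      disjoint (j , j∈) with x∈p∩q⁻ (dual B x) (dual B y) j∈
      ... | j∈x , j∈y = x≢y (∣p∣≡1⇒unique (transversal j i) (x∈p∩q⁺ (∈-dual⁻ j∈x , x∈)) (x∈p∩q⁺ (∈-dual⁻ j∈y , y∈)))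

    -- Each point lies on k blocks, the block size of the dual, and at most l of them are common to
    -- both points. So at least 2(k - l) blocks separate the two.
    sum-agrees-≤ : l ≤ k → ∀ {x y} → x ≢ y → sum (λ j → # agrees j (x , y)) ≤ b ∸ 2 * (k ∸ l)
    sum-agrees-≤ l≤k {x} {y} x≢y = ℕₚ.m+n≤o⇒m≤o∸n s (ℕₚ.+-cancelʳ-≤ (2 * l) _ _ (begin
      s + 2 * (k ∸ l) + 2 * l                ≡⟨ nat s (k ∸ l) l ⟩
      s + ((k ∸ l + l) + (k ∸ l + l))        ≡⟨ cong (λ t → s + (t + t)) (ℕₚ.m∸n+n≡m l≤k) ⟩
      s + (k + k)                            ≡⟨ cong₂ (λ p q → s + (p + q)) (∣dual∣≡k x) (∣dual∣≡k y) ⟨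
      s + (∣ dual B x ∣ + ∣ dual B y ∣)      ≡⟨ sum-agrees x y ⟩
      b + 2 * ∣ dual B x ∩ dual B y ∣        ≤⟨ ℕₚ.+-monoʳ-≤ b (ℕₚ.*-monoʳ-≤ 2 (∣dual∩dual∣≤l x≢y)) ⟩
      b + 2 * l                              ∎))
      where
      open ℕₚ.≤-Reasoning
      s = sum (λ j → # agrees j (x , y))
      nat : ∀ s d l → s + 2 * d + 2 * l ≡ s + ((d + l) + (d + l))
      nat = solve-∀

    semiResolving : ∀ n → l ≤ k → n ≤ b → v ^ 2 * (b ∸ 2 * (k ∸ l)) ^ n < 2 * b ^ n →
                    ∃ λ S → ∣ S ∣ ≡ n × SemiResolvingForPoints B S
    semiResolving n l≤k n≤b lt with greedy agrees w n L (All.map (sum-agrees-≤ l≤k) (pairs⁺ (allFin⁺ v))) lt′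
      where
      w = b ∸ 2 * (k ∸ l)
      L = pairs (allFin v)
      2L≤v² : 2 * length L ≤ v ^ 2
      2L≤v² = subst (λ t → 2 * length L ≤ t ^ 2) (length-tabulate {n = v} id) (2*length-pairs (allFin v))
      lt′ : length L * w ^ n < b ^ n
      -- The number of pairs enters doubled, so that it compares with v² without a division.
      lt′ = ℕₚ.*-cancelˡ-< 2 _ _ (ℕₚ.≤-<-trans
        (ℕₚ.≤-trans (ℕₚ.≤-reflexive (sym (ℕₚ.*-assoc 2 (length L) (w ^ n)))) (ℕₚ.*-monoˡ-≤ (w ^ n) 2L≤v²)) lt)
    ... | S , ∣S∣≤n , hits with extend S n ∣S∣≤n n≤b
    ...   | T , S⊆T , ∣T∣≡n = T , ∣T∣≡n , resolve
      where
      resolve : SemiResolvingForPoints B T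
      resolve x y x≢y with pairs⁻ {R = λ x y → HitBy agrees S (x , y)} (allFin v) hits (∈-allFin x) (∈-allFin y) x≢y
      ... | inj₁ (j , j∈ , hit) = j , S⊆T j∈ , disagrees⇒one j x y hit
      ... | inj₂ (j , j∈ , hit) = j , S⊆T j∈ , Sum.[ (λ (y∈ , x∉) → inj₂ (x∉ , y∈)) , (λ (y∉ , x∈) → inj₁ (x∈ , y∉)) ] (disagrees⇒one j y x hit)

    -- The path is j, y, j′, x: y is the point of j in a class other than that of x, and l ≥ 1
    -- supplies a block j′ through x and y. A walk from a block to a point has odd length, and
    -- length 1 would mean incidence.
    distance-∉ : 1 ≤ l → 2 ≤ k → ∀ {j x} → ¬ (x ∈ B j) → IsDistance (inj₂ j) (inj₁ x) 3
    distance-∉ 1≤l 2≤k {j} {x} x∉ with partition x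
    ... | i , x∈i , _ with ∃-other 2≤k i
    ... | i′ , i≢i′ with nonempty (ℕₚ.≤-reflexive (sym (transversal j i′)))
    ... | y , y∈ with x∈p∩q⁻ (B j) (G i′) y∈
    ... | y∈j , y∈i′ with nonempty (subst (1 ≤_) (sym (balanced x∈i y∈i′ i≢i′)) 1≤l)
    ... | j′ , j′∈ with x∈p∩q⁻ (dual B x) (dual B y) j′∈
    ... | j′∈x , j′∈y = _∷_ {w = inj₁ y} y∈j (_∷_ {w = inj₂ j′} (∈-dual⁻ j′∈y) (∈-dual⁻ j′∈x ∷ [])) , shortest
      where
      shortest : ∀ {n} → Walk (inj₂ j) (inj₁ x) n → 3 ≤ n
      shortest (_∷_ {w = inj₁ _} x∈ []) = contradiction x∈ x∉
      shortest (_∷_ {w = inj₁ _} _ (_∷_ {w = inj₂ _} _ (_ ∷ _))) = s≤s (s≤s (s≤s z≤n))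

    -- Points are at distance 1 or 3 from a block, according to incidence.
    exactlyOne⇔distances : 1 ≤ l → 2 ≤ k → ∀ j x y →
      ContainsExactlyOne (B j) x y ⇔ AtDifferentDistances (inj₂ j) (inj₁ x) (inj₁ y)
    exactlyOne⇔distances 1≤l 2≤k j x y = mk⇔ to from
      where
      to : ContainsExactlyOne (B j) x y → AtDifferentDistances (inj₂ j) (inj₁ x) (inj₁ y)
      to (inj₁ (x∈ , y∉)) = 1 , 3 , distance-∈ x∈ , distance-∉ 1≤l 2≤k y∉ , λ()
      to (inj₂ (x∉ , y∈)) = 3 , 1 , distance-∉ 1≤l 2≤k x∉ , distance-∈ y∈ , λ()
      from : AtDifferentDistances (inj₂ j) (inj₁ x) (inj₁ y) → ContainsExactlyOne (B j) x y
      from (d , d′ , dx , dy , d≢d′) with x ∈? B j | y ∈? B j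
      ... | yes x∈ | no  y∉ = inj₁ (x∈ , y∉)
      ... | no  x∉ | yes y∈ = inj₂ (x∉ , y∈)
      ... | yes x∈ | yes y∈ = contradiction (trans (distance-unique dx (distance-∈ x∈)) (distance-unique (distance-∈ y∈) dy)) d≢d′
      ... | no  x∉ | no  y∉ = contradiction (trans (distance-unique dx (distance-∉ 1≤l 2≤k x∉)) (distance-unique (distance-∉ 1≤l 2≤k y∉) dy)) d≢d′

theorem3p3 : ∀ (l k g v b : ℕ) (B : Fin b → Subset v) →
    SymmetricTransversalDesign l k g B →
    1 ≤ l → 2 ≤ g → (l , g) ∉ ((1 , 2) ∷ (1 , 3) ∷ (2 , 2) ∷ []) →
    -- Well-definedness of the quotient by k - l.
    .{{_ : NonZero (k ∸ l)}} →
    (v ≡ l * g ^ 2 × k ≡ l * g) ×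
    (∀ n → IsCeiling (+ n) ((+ v / (k ∸ l)) · log v) →
      ∃ λ (S : Subset b) → ∣ S ∣ ≡ n × SemiResolvingForPoints B S) ×
    (∀ j x y → ContainsExactlyOne (B j) x y ⇔
      IncidenceGraph.AtDifferentDistances B (inj₂ j) (inj₁ x) (inj₁ y))
theorem3p3 l k g@(suc h) v b B D 1≤l 2≤g@(s≤s 1≤h) ∉ =
  (v≡lg² , k≡lg) , resolving , exactlyOne⇔distances B D 1≤l 2≤k
  where
  open SymmetricTransversalDesign D
  open TransversalDesign design using (points)
  d = k ∸ l
  w = v ∸ 2 * d
  l<k : l < k
  -- A nonzero truncated difference forces l < k. With l ≥ 1 this gives k ≥ 2, hence the second
  -- class on which the count for k = l g relies.
  l<k = ℕₚ.m∸n≢0⇒n<m (ℕ.≢-nonZero⁻¹ d)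
  l≤k : l ≤ k
  l≤k = ℕₚ.<⇒≤ l<k
  2≤k : 2 ≤ k
  2≤k = ℕₚ.≤-trans (s≤s 1≤l) l<k
  b≡v : b ≡ v
  b≡v = trans (TransversalDesign.points dual-design) (sym points)
  k≡lg : k ≡ l * g
  k≡lg = k≡l*g B D 2≤k (fromℕ< (subst (1 ≤_) (sym points) (ℕₚ.*-mono-≤ (ℕₚ.<⇒≤ 2≤k) (ℕₚ.<⇒≤ 2≤g))))
  v≡l[gg] : v ≡ l * (g * g)
  v≡l[gg] = trans points (trans (cong (_* g) k≡lg) (ℕₚ.*-assoc l g g))
  v≡lg² : v ≡ l * g ^ 2
  v≡lg² = trans v≡l[gg] (cong (λ t → l * (g * t)) (sym (ℕₚ.*-identityʳ g)))
  lh≡d : l * h ≡ d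
  lh≡d = sym (trans (cong (_∸ l) (trans k≡lg (ℕₚ.*-suc l h))) (ℕₚ.m+n∸m≡n l (l * h)))
  -- This keeps w = v - 2d positive, so that the harmonic sums starting at wⁿ make sense, and makes
  -- w + 2d = v exact.
  2d<v : 2 * d < v
  2d<v = begin-strict
    2 * d   <⟨ ℕₚ.*-monoʳ-< 2 (ℕₚ.∸-monoʳ-< 1≤l l≤k) ⟩
    2 * k   ≤⟨ ℕₚ.*-monoˡ-≤ k 2≤g ⟩
    g * k   ≡⟨ ℕₚ.*-comm g k ⟩
    k * g   ≡⟨ points ⟨
    v       ∎
    where open ℕₚ.≤-Reasoning
  resolving : ∀ n → IsCeiling (+ n) ((+ v / d) · log v) → ∃ λ S → ∣ S ∣ ≡ n × SemiResolvingForPoints B S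
  resolving n (lower , upper) = semiResolving B D n l≤k
    (subst (n ≤_) (sym b≡v)
      (ceiling-≤ (subst₂ LogBelow (sym v≡l[gg]) lh≡d (logBelow-design l h 1≤l 1≤h ∉)) lower))
    (subst (λ t → v ^ 2 * (t ∸ 2 * d) ^ n < 2 * t ^ n) (sym b≡v)
      (power-bound n (ℕₚ.m<n⇒0<n∸m 2d<v) (ℕₚ.m∸n+n≡m (ℕₚ.<⇒≤ 2d<v)) upper))
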